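{- Connected Vertex Cover parameterized by the size of a clique cover is $W[1]$-hard. That is, the following parameterized problem is $W[1]$-hard with respect to parameter $k$: given a graph $G$, a clique cover of $G$ of size $k$, and a positive integer $\ell$, decide whether $G$ has a connected vertex cover of size at most $\ell$.
   Context: All graphs are finite, simple and undirected. A connected vertex cover of $G$ is a set $T\subseteq V(G)$ containing an endpoint of every edge of $G$ such that $G[T]$ is connected. A clique cover of $G$ is a partition of $V(G)$ such that each part induces a clique; its size is the number of parts. $W[1]$-hardness is with respect to parameterized (FPT) reductions; for instance, Independent Set parameterized by solution size is a standard $W[1]$-hard problem. -}

module Defs where

open import Data.Bool using (Bool; true; false)
open import Data.Fin using (Fin; toℕ)
open import Data.Fin.Subset using (Subset; _∈_; _∉_; ∣_∣)
open import Data.List using (List; []; _∷_; allFin; length)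
open import Data.List.Relation.Unary.All using (All)
open import Data.List.Relation.Unary.Any using (Any)
open import Data.Nat using (ℕ; zero; suc; _+_; _*_; _^_; _≤_; _>_)
open import Data.Product using (Σ; ∃-syntax; _×_)
open import Data.Sum using (_⊎_)
open import Data.Vec using (Vec; []; _∷_; lookup)
open import Function.Bundles using (_⇔_)
open import Function.Definitions using (Surjective)
open import Relation.Binary.Construct.Closure.ReflexiveTransitive using (Star)
open import Relation.Binary.PropositionalEquality using (_≡_; _≢_)

------------------------------------------------------------------------
-- Model of computation
--
-- A first-order language over binary trees with an unbounded loop, in the
-- style of Jones' WHILE: every evaluation step costs one unit.  Trees are
-- shared pointer structures, so t steps allocate at most t cells and the
-- running time is polynomially related to Turing machine time, provided
-- the size of the (unfolded) output is charged as well; `Runs` does so.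

data Tree : Set where
  leaf : Tree
  _∙_  : Tree → Tree → Tree

infixr 5 _∙_

size : Tree → ℕ
size leaf    = 1
size (s ∙ t) = suc (size s + size t)

-- Terms with n free variables (de Bruijn indices).
data Term (n : ℕ) : Set where
  var  : Fin n → Term n
  leaf : Term n
  node : Term n → Term n → Term n
  case : Term n → Term n → Term (2 + n) → Term n
  bind : Term n → Term (1 + n) → Term n
  loop : Term n → Term (1 + n) → Term n

infix 4 _⊢_⇓_∣_ _⊢_⟲_⇓_∣_

mutual

  -- ρ ⊢ e ⇓ v ∣ t : in environment ρ, e evaluates to v in t steps.
  data _⊢_⇓_∣_ {n : ℕ} (ρ : Vec Tree n) : Term n → Tree → ℕ → Set where
    var : ∀ i → ρ ⊢ var i ⇓ lookup ρ i ∣ 1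
    leaf : ρ ⊢ leaf ⇓ leaf ∣ 1
    node : ∀ {e₁ e₂ v₁ v₂ t₁ t₂} →
           ρ ⊢ e₁ ⇓ v₁ ∣ t₁ → ρ ⊢ e₂ ⇓ v₂ ∣ t₂ →
           ρ ⊢ node e₁ e₂ ⇓ v₁ ∙ v₂ ∣ suc (t₁ + t₂)
    case-leaf : ∀ {e e₁ e₂ v t₁ t₂} →
           ρ ⊢ e ⇓ leaf ∣ t₁ → ρ ⊢ e₁ ⇓ v ∣ t₂ →
           ρ ⊢ case e e₁ e₂ ⇓ v ∣ suc (t₁ + t₂)
    case-node : ∀ {e e₁ e₂ l r v t₁ t₂} →
           ρ ⊢ e ⇓ l ∙ r ∣ t₁ → (l ∷ r ∷ ρ) ⊢ e₂ ⇓ v ∣ t₂ →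
           ρ ⊢ case e e₁ e₂ ⇓ v ∣ suc (t₁ + t₂)
    bind : ∀ {e₁ e₂ u v t₁ t₂} →
           ρ ⊢ e₁ ⇓ u ∣ t₁ → (u ∷ ρ) ⊢ e₂ ⇓ v ∣ t₂ →
           ρ ⊢ bind e₁ e₂ ⇓ v ∣ suc (t₁ + t₂)
    loop : ∀ {e b u v t₁ t₂} →
           ρ ⊢ e ⇓ u ∣ t₁ → ρ ⊢ b ⟲ u ⇓ v ∣ t₂ →
           ρ ⊢ loop e b ⇓ v ∣ suc (t₁ + t₂)

  -- ρ ⊢ b ⟲ u ⇓ v ∣ t : iterating the body b from state u ends with v
  -- after t steps.  The left component of the body's value says whether to
  -- stop (leaf) or go on (a node); the right component is the new state.
  data _⊢_⟲_⇓_∣_ {n : ℕ} (ρ : Vec Tree n) (b : Term (1 + n)) :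
                 Tree → Tree → ℕ → Set where
    stop : ∀ {u v t} →
           (u ∷ ρ) ⊢ b ⇓ leaf ∙ v ∣ t →
           ρ ⊢ b ⟲ u ⇓ v ∣ suc t
    next : ∀ {u l r u′ v t₁ t₂} →
           (u ∷ ρ) ⊢ b ⇓ (l ∙ r) ∙ u′ ∣ t₁ → ρ ⊢ b ⟲ u′ ⇓ v ∣ t₂ →
           ρ ⊢ b ⟲ u ⇓ v ∣ suc (t₁ + t₂)

Program : Set
Program = Term 1

-- p maps input u to output v in time at most b, writing the output included.
Runs : Program → Tree → Tree → ℕ → Set
Runs p u v b = ∃[ t ] (u ∷ []) ⊢ p ⇓ v ∣ t × t + size v ≤ b

------------------------------------------------------------------------
-- Encodings

encℕ : ℕ → Tree
encℕ zero    = leaf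
encℕ (suc n) = leaf ∙ encℕ n

encBool : Bool → Tree
encBool false = leaf
encBool true  = leaf ∙ leaf

encFin : ∀ {n} → Fin n → Tree
encFin i = encℕ (toℕ i)

encList : ∀ {A : Set} → (A → Tree) → List A → Tree
encList enc []       = leaf
encList enc (x ∷ xs) = enc x ∙ encList enc xs

Computable : (ℕ → ℕ) → Set
Computable f = Σ Program λ p → ∀ k → ∃[ b ] Runs p (encℕ k) (encℕ (f k)) b

------------------------------------------------------------------------
-- Parameterized problems and FPT reductions

-- Only trees that encode an instance are constrained, so these are promise
-- problems.  Languages L ⊆ Tree × ℕ are the case Instance = Tree × ℕ.
record Problem : Set₁ where
  field
    Instance : Set
    encode   : Instance → Tree
    param    : Instance → ℕ
    Yes      : Instance → Set

  -- The pair (x , k) of an instance and its parameter, as programs see it.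
  input : Instance → Tree
  input x = encode x ∙ encℕ (param x)

open Problem

infix 4 _≤ᶠᵖᵗ_

record _≤ᶠᵖᵗ_ (A B : Problem) : Set where
  field
    reduce       : Instance A → Instance B
    correct      : ∀ x → Yes A x ⇔ Yes B (reduce x)

    g            : ℕ → ℕ
    g-computable : Computable g
    param-bound  : ∀ x → param B (reduce x) ≤ g (param A x)

    f            : ℕ → ℕ
    f-computable : Computable f
    c            : ℕ
    program      : Program
    runs         : ∀ x → Runs program (input A x) (input B (reduce x))
                              (f (param A x) * size (input A x) ^ c)

------------------------------------------------------------------------
-- The class W[1]

data Literal (n : ℕ) : Set where
  pos neg : Fin n → Literal n

encLiteral : ∀ {n} → Literal n → Tree
encLiteral (pos i) = encBool true  ∙ encFin i
encLiteral (neg i) = encBool false ∙ encFin i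

Clause : ℕ → Set
Clause n = List (Literal n)

-- An assignment is the set of variables that it makes true.
⟦_⟧ : ∀ {n} → Literal n → Subset n → Set
⟦ pos i ⟧ S = i ∈ S
⟦ neg i ⟧ S = i ∉ S

Satisfies : ∀ {n} → Subset n → List (Clause n) → Set
Satisfies S φ = All (Any (λ l → ⟦ l ⟧ S)) φ

record WSatInstance (d : ℕ) : Set where
  field
    vars    : ℕ
    clauses : List (Clause vars)
    width   : All (λ C → length C ≤ d) clauses
    weight  : ℕ

-- Weighted d-CNF satisfiability: is there a satisfying assignment making
-- exactly k variables true?  The parameter is k.
WeightedCNFSat : ℕ → Problem
WeightedCNFSat d = record
  { Instance = WSatInstance d
  ; encode   = λ x → encℕ (vars x) ∙ encList (encList encLiteral) (clauses x)
  ; param    = weight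
  ; Yes      = λ x → ∃[ S ] ∣ S ∣ ≡ weight x × Satisfies S (clauses x)
  }
  where open WSatInstance

-- W[t] is the closure under FPT reductions of weighted satisfiability for the
-- formula classes Γ_{t,d}, d ≥ 1 (Flum and Grohe); Γ_{1,d} consists of the
-- conjunctions of clauses with at most d literals.
W[1] : Problem → Set
W[1] A = ∃[ d ] A ≤ᶠᵖᵗ WeightedCNFSat d

W[1]-Hard : Problem → Set₁
W[1]-Hard B = ∀ A → W[1] A → A ≤ᶠᵖᵗ B

------------------------------------------------------------------------
-- Graphs

record Graph (n : ℕ) : Set where
  field
    adj    : Fin n → Fin n → Bool
    sym    : ∀ u v → adj u v ≡ adj v u
    irrefl : ∀ u → adj u u ≡ false

  Adj : Fin n → Fin n → Set
  Adj u v = adj u v ≡ true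

open Graph using (Adj; adj)

encGraph : ∀ {n} → Graph n → Tree
encGraph {n} G = encList (λ u → encList (λ v → encBool (adj G u v)) (allFin n))
                         (allFin n)

IsVertexCover : ∀ {n} → Graph n → Subset n → Set
IsVertexCover G T = ∀ u v → Adj G u v → u ∈ T ⊎ v ∈ T

-- Adjacency in the induced subgraph G[T].
InducedAdj : ∀ {n} → Graph n → Subset n → Fin n → Fin n → Set
InducedAdj G T u v = u ∈ T × v ∈ T × Adj G u v

-- The empty set counts as connected.  Since ℓ > 0 below, this convention only
-- affects the graph with no vertices.
InducesConnected : ∀ {n} → Graph n → Subset n → Set
InducesConnected G T = ∀ u v → u ∈ T → v ∈ T → Star (InducedAdj G T) u v

IsConnectedVertexCover : ∀ {n} → Graph n → Subset n → Set
IsConnectedVertexCover G T = IsVertexCover G T × InducesConnected G T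

-- A partition of the vertices into k cliques, given by the map sending each
-- vertex to its part; surjectivity says that every part is nonempty.
record CliqueCover {n : ℕ} (G : Graph n) (k : ℕ) : Set where
  field
    part       : Fin n → Fin k
    surjective : Surjective _≡_ _≡_ part
    clique     : ∀ u v → part u ≡ part v → u ≢ v → Adj G u v

------------------------------------------------------------------------
-- Connected Vertex Cover parameterized by the size of a clique cover

record CVCInstance : Set where
  field
    order : ℕ
    graph : Graph order
    k     : ℕ
    cover : CliqueCover graph k
    ℓ     : ℕ
    ℓ>0   : ℓ > 0

-- Writing ℓ in unary makes the hardness claim no weaker: a unary ℓ is
-- converted to binary in polynomial time.
encCVC : CVCInstance → Tree
encCVC x = encGraph graph ∙ encList (λ v → encFin (part v)) (allFin order) ∙ encℕ ℓ
  where
    open CVCInstance x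
    open CliqueCover cover

ConnectedVertexCover/CliqueCover : Problem
ConnectedVertexCover/CliqueCover = record
  { Instance = CVCInstance
  ; encode   = encCVC
  ; param    = k
  ; Yes      = λ x → ∃[ T ] IsConnectedVertexCover (graph x) T × ∣ T ∣ ≤ ℓ x
  }
  where open CVCInstance

{-# OPTIONS --safe #-}

-- Let s₁ < … < s_k be the positions (variable v has position v + 1) of the true
-- variables of a weight-k assignment, with sentinels s₀ = 0, s_{k+1} = n + 1 and
-- s_{k+2} = n + 2.  A literal is falsified by a single pair (s_i , s_{i+1}):
-- ¬v when s_i = v + 1, and v when s_i < v + 1 < s_{i+1}.  So a clause with at
-- most d literals is violated exactly when d + 1 such pairs falsify all of it.
-- The vertices are the (d + 1)-tuples of triples (i , a , b), read as s_i = a and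
-- s_{i+1} = b, grouped into K = (k + 2)^(d + 1) cliques by their indices i; two
-- vertices are also adjacent when their triples contradict each other or
-- together falsify a clause.  Satisfying assignments of weight k correspond to
-- independent sets of size K.  A tuple containing a ≥ b is adjacent to every
-- other vertex, hence lies in the complement of each independent set of size
-- K ≥ 2 and makes that complement connected.
--
-- The vertex list is polynomial in the unary input for fixed d, so no f(k)-time
-- step is needed.  Its running time is tracked compositionally: all loops are
-- folds whose accumulators stay polynomially bounded.

module Submission where

open import Defs
open import Data.Bool.Base using (Bool; true; false; not; _∧_; _∨_; if_then_else_; T)
open import Data.Bool.ListAction using (any; all)
import Data.Bool.Properties as Bool
open import Data.Fin.Base using (Fin; zero; suc; toℕ; fromℕ<; punchOut)
import Data.Fin.Properties as Fin
open import Data.Fin.Subset using (Subset; _∈_; _∉_; ∣_∣; ∁; ⁅_⁆)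
import Data.Fin.Subset.Properties as Subset
open import Data.List.Base as List using
  (List; []; _∷_; _++_; foldl; take; length; concatMap; _ʳ++_; reverse;
   downFrom; cartesianProductWith; [_]; map; replicate; allFin)
import Data.List.Membership.Propositional as Mem
import Data.List.Membership.Propositional.Properties as List
import Data.List.Properties as List
open import Data.List.Relation.Unary.All as All using (All; []; _∷_)
import Data.List.Relation.Unary.All.Properties as All
open import Data.List.Relation.Unary.AllPairs using ([]; _∷_)
open import Data.List.Relation.Unary.Any as Any using (Any; here; there)
import Data.List.Relation.Unary.Any.Properties as Any
open import Data.List.Relation.Unary.Unique.Propositional using (Unique)
import Data.List.Relation.Unary.Unique.Propositional.Properties as Unique
open import Data.Nat.Base
open import Data.Nat.DivMod using (_%_; _/_; m%n<n; m<n⇒m%n≡m; [m+kn]%n≡m%n; m≡m%n+[m/n]*n; m<n*o⇒m/o<n)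
open import Data.Nat.Properties
open import Data.Product.Base using (∃-syntax; _×_; _,_; proj₁; proj₂)
open import Data.Product.Properties using (≡-dec)
open import Data.Sum.Base using (_⊎_; inj₁; inj₂; [_,_]′)
open import Data.Unit.Base using (⊤; tt)
open import Data.Vec.Base as Vec using (Vec; []; _∷_; lookup)
import Data.Vec.Properties as Vec
import Data.Vec.Relation.Unary.All as VecAll
open VecAll using ([]; _∷_) renaming (All to VAll)
import Data.Vec.Relation.Unary.All.Properties as VecAll
open import Function.Base using (id; _∘_)
open import Function.Bundles using (_⇔_; mk⇔; module Equivalence)
open import Function.Construct.Composition using (_⇔-∘_)
open import Relation.Binary.Construct.Closure.ReflexiveTransitive using (Star; ε; _◅_)
open import Relation.Binary.Definitions using (tri<; tri≈; tri>)
open import Relation.Binary.PropositionalEquality hiding ([_])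
open import Relation.Nullary using (¬_; Dec; yes; no; contradiction; does; _×-dec_; ¬?)
open import Relation.Nullary.Decidable using (decidable-stable)
open Equivalence using (to; from)

-- Polynomial-time functions

ext : ∀ {m n} → (Fin m → Fin n) → Fin (suc m) → Fin (suc n)
ext r zero    = zero
ext r (suc i) = suc (r i)

rename : ∀ {m n} → (Fin m → Fin n) → Term m → Term n
rename r (var i)       = var (r i)
rename r leaf          = leaf
rename r (node e₁ e₂)  = node (rename r e₁) (rename r e₂)
rename r (case e e₁ e₂) = case (rename r e) (rename r e₁) (rename (ext (ext r)) e₂)
rename r (bind e₁ e₂)  = bind (rename r e₁) (rename (ext r) e₂)
rename r (loop e b)    = loop (rename r e) (rename (ext r) b)

_≼[_]_ : ∀ {m n} → Vec Tree m → (Fin m → Fin n) → Vec Tree n → Set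
ρ ≼[ r ] σ = ∀ i → lookup ρ i ≡ lookup σ (r i)

ext-≼ : ∀ {m n} {ρ : Vec Tree m} {σ : Vec Tree n} {r} u → ρ ≼[ r ] σ → (u ∷ ρ) ≼[ ext r ] (u ∷ σ)
ext-≼ u h zero    = refl
ext-≼ u h (suc i) = h i

mutual
  rename-⇓ : ∀ {m n} {ρ : Vec Tree m} {σ : Vec Tree n} {r e v t} →
             ρ ≼[ r ] σ → ρ ⊢ e ⇓ v ∣ t → σ ⊢ rename r e ⇓ v ∣ t
  rename-⇓ {σ = σ} {r = r} h (var i) rewrite h i = var (r i)
  rename-⇓ h leaf            = leaf
  rename-⇓ h (node p q)      = node (rename-⇓ h p) (rename-⇓ h q)
  rename-⇓ h (case-leaf p q) = case-leaf (rename-⇓ h p) (rename-⇓ h q)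
  rename-⇓ h (case-node p q) = case-node (rename-⇓ h p) (rename-⇓ (ext-≼ _ (ext-≼ _ h)) q)
  rename-⇓ h (bind p q)      = bind (rename-⇓ h p) (rename-⇓ (ext-≼ _ h) q)
  rename-⇓ h (loop p q)      = loop (rename-⇓ h p) (rename-⟲ h q)

  rename-⟲ : ∀ {m n} {ρ : Vec Tree m} {σ : Vec Tree n} {r b u v t} →
             ρ ≼[ r ] σ → ρ ⊢ b ⟲ u ⇓ v ∣ t → σ ⊢ rename (ext r) b ⟲ u ⇓ v ∣ t
  rename-⟲ h (stop p)   = stop (rename-⇓ (ext-≼ _ h) p)
  rename-⟲ h (next p q) = next (rename-⇓ (ext-≼ _ h) p) (rename-⟲ h q)

-- A program has a single free variable; sending it to index zero runs it on the value bound last,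
-- in any environment. Looking up a variable costs one step whatever its index, so step counts are
-- unchanged.
call : ∀ {n} → Term 1 → Term (suc n)
call = rename (λ _ → zero)

call-⇓ : ∀ {n} {ρ : Vec Tree n} {u p v t} → (u ∷ []) ⊢ p ⇓ v ∣ t → (u ∷ ρ) ⊢ call p ⇓ v ∣ t
call-⇓ = rename-⇓ λ { zero → refl }

-- Polynomial bounds.

infixl 6 _⊕_
infixl 7 _⊛_
infixr 8 _⊙_

-- Syntax for polynomials with natural coefficients, so that bounds are assembled along with
-- programs. Every such polynomial is monotone, and `⊙` is composition.
data Poly : Set where
  inp         : Poly
  con         : ℕ → Poly
  _⊕_ _⊛_ _⊙_ : Poly → Poly → Poly

⟦_⟧ₚ : Poly → ℕ → ℕ
⟦ inp ⟧ₚ s     = s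
⟦ con c ⟧ₚ s = c
⟦ p ⊕ q ⟧ₚ s = ⟦ p ⟧ₚ s + ⟦ q ⟧ₚ s
⟦ p ⊛ q ⟧ₚ s = ⟦ p ⟧ₚ s * ⟦ q ⟧ₚ s
⟦ p ⊙ q ⟧ₚ s = ⟦ p ⟧ₚ (⟦ q ⟧ₚ s)

⟦⟧ₚ-mono : ∀ p {s s′} → s ≤ s′ → ⟦ p ⟧ₚ s ≤ ⟦ p ⟧ₚ s′
⟦⟧ₚ-mono inp       h = h
⟦⟧ₚ-mono (con c) h = ≤-refl
⟦⟧ₚ-mono (p ⊕ q) h = +-mono-≤ (⟦⟧ₚ-mono p h) (⟦⟧ₚ-mono q h)
⟦⟧ₚ-mono (p ⊛ q) h = *-mono-≤ (⟦⟧ₚ-mono p h) (⟦⟧ₚ-mono q h)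
⟦⟧ₚ-mono (p ⊙ q) h = ⟦⟧ₚ-mono p (⟦⟧ₚ-mono q h)

[m*n]^o≡m^o*n^o : ∀ m n o → (m * n) ^ o ≡ m ^ o * n ^ o
[m*n]^o≡m^o*n^o m n zero    = refl
[m*n]^o≡m^o*n^o m n (suc o) rewrite [m*n]^o≡m^o*n^o m n o =
  [m*n]*[o*p]≡[m*o]*[n*p] m n (m ^ o) (n ^ o)

-- Brings any bound into the monomial shape that an FPT reduction asks for. Positivity of `s` lets
-- exponents be raised to a common one.
⟦⟧ₚ-degree : ∀ p → ∃[ c ] ∃[ d ] ∀ s → 1 ≤ s → ⟦ p ⟧ₚ s ≤ c * s ^ d
⟦⟧ₚ-degree inp = 1 , 1 , λ s _ → ≤-reflexive (sym (trans (*-identityˡ _) (*-identityʳ s)))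
⟦⟧ₚ-degree (con c) = c , 0 , λ s _ → ≤-reflexive (sym (*-identityʳ c))
⟦⟧ₚ-degree (p ⊕ q) with ⟦⟧ₚ-degree p | ⟦⟧ₚ-degree q
... | c , d , hp | c′ , d′ , hq = c + c′ , d + d′ , bound
  where
  bound : ∀ s → 1 ≤ s → ⟦ p ⟧ₚ s + ⟦ q ⟧ₚ s ≤ (c + c′) * s ^ (d + d′)
  bound s@(suc _) 1≤s = begin
    ⟦ p ⟧ₚ s + ⟦ q ⟧ₚ s                          ≤⟨ +-mono-≤ (hp s 1≤s) (hq s 1≤s) ⟩
    c * s ^ d + c′ * s ^ d′                      ≤⟨ +-mono-≤ (*-monoʳ-≤ c (^-monoʳ-≤ s (m≤m+n d d′)))
                                                             (*-monoʳ-≤ c′ (^-monoʳ-≤ s (m≤n+m d′ d))) ⟩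
    c * s ^ (d + d′) + c′ * s ^ (d + d′)         ≡⟨ *-distribʳ-+ (s ^ (d + d′)) c c′ ⟨
    (c + c′) * s ^ (d + d′)                      ∎
    where open ≤-Reasoning
⟦⟧ₚ-degree (p ⊛ q) with ⟦⟧ₚ-degree p | ⟦⟧ₚ-degree q
... | c , d , hp | c′ , d′ , hq = c * c′ , d + d′ , λ s 1≤s → begin
    ⟦ p ⟧ₚ s * ⟦ q ⟧ₚ s                          ≤⟨ *-mono-≤ (hp s 1≤s) (hq s 1≤s) ⟩
    c * s ^ d * (c′ * s ^ d′)                    ≡⟨ [m*n]*[o*p]≡[m*o]*[n*p] c (s ^ d) c′ (s ^ d′) ⟩
    c * c′ * (s ^ d * s ^ d′)                    ≡⟨ cong (c * c′ *_) (^-distribˡ-+-* s d d′) ⟨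
    c * c′ * s ^ (d + d′)                        ∎
    where open ≤-Reasoning
⟦⟧ₚ-degree (p ⊙ q) with ⟦⟧ₚ-degree p | ⟦⟧ₚ-degree q
... | c , d , hp | c′ , d′ , hq = c * suc c′ ^ d , d′ * d , bound
  where
  bound : ∀ s → 1 ≤ s → ⟦ p ⟧ₚ (⟦ q ⟧ₚ s) ≤ c * suc c′ ^ d * s ^ (d′ * d)
  bound s@(suc _) 1≤s = begin
    -- `suc c′` in place of `c′` keeps the argument positive, as the bound for `p` demands.
    ⟦ p ⟧ₚ (⟦ q ⟧ₚ s)                 ≤⟨ ⟦⟧ₚ-mono p (≤-trans (hq s 1≤s) (*-monoˡ-≤ (s ^ d′) (n≤1+n c′))) ⟩
    ⟦ p ⟧ₚ (suc c′ * s ^ d′)          ≤⟨ hp _ (*-mono-≤ {1} {suc c′} {1} {s ^ d′} (s≤s z≤n) (m^n>0 s d′)) ⟩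
    c * (suc c′ * s ^ d′) ^ d         ≡⟨ cong (c *_) ([m*n]^o≡m^o*n^o (suc c′) (s ^ d′) d) ⟩
    c * (suc c′ ^ d * (s ^ d′) ^ d)   ≡⟨ *-assoc c (suc c′ ^ d) _ ⟨
    c * suc c′ ^ d * (s ^ d′) ^ d     ≡⟨ cong (c * suc c′ ^ d *_) (^-*-assoc s d′ d) ⟩
    c * suc c′ ^ d * s ^ (d′ * d)     ∎
    where open ≤-Reasoning

-- Coded types and polynomial-time maps.

record Coded : Set₁ where
  constructor coded
  field
    Carrier : Set
    enc     : Carrier → Tree

open Coded public

infixr 2 _⊗_
infix 1 _⇝_

_⊗_ : Coded → Coded → Coded
A ⊗ B = coded (Carrier A × Carrier B) λ { (a , b) → enc A a ∙ enc B b }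

𝕃 : Coded → Coded
𝕃 A = coded (List (Carrier A)) (encList (enc A))

𝕍 : Coded → ℕ → Coded
𝕍 A n = coded (Vec (Carrier A) n) (λ xs → encList (enc A) (Vec.toList xs))

ℕᶜ 𝔹 : Coded
ℕᶜ = coded ℕ encℕ
𝔹  = coded Bool encBool

-- Polynomial-time functions with an explicit program. `space` does not follow from `time`: subtrees
-- are shared, so the unfolded size can double within a few steps. Composition needs it, since the
-- second program runs on the output of the first.
record _⇝_ (A B : Coded) : Set where
  field
    fun     : Carrier A → Carrier B
    term    : Term 1
    time    : Poly
    space   : Poly
    correct : ∀ a → ∃[ t ] (enc A a ∷ []) ⊢ term ⇓ enc B (fun a) ∣ t × t ≤ ⟦ time ⟧ₚ (size (enc A a))
    small   : ∀ a → size (enc B (fun a)) ≤ ⟦ space ⟧ₚ (size (enc A a))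

open _⇝_ public

-- Keeps program and bounds but exchanges the function for a pointwise equal one, so that a compound
-- program carries the plain definition that later proofs reason about.
with-fun : ∀ {A B} (c : A ⇝ B) (f : Carrier A → Carrier B) → (∀ a → fun c a ≡ f a) → A ⇝ B
with-fun {A} {B} c f eq = record
  { fun     = f
  ; term    = term c
  ; time    = time c
  ; space   = space c
  ; correct = λ a → subst (λ b → ∃[ t ] (enc A a ∷ []) ⊢ term c ⇓ enc B b ∣ t × t ≤ _) (eq a) (correct c a)
  ; small   = λ a → subst (λ b → size (enc B b) ≤ _) (eq a) (small c a)
  }

idᶜ : ∀ {A} → A ⇝ A
idᶜ = record
  { fun = id ; term = var zero ; time = con 1 ; space = inp
  ; correct = λ a → 1 , var zero , ≤-refl ; small = λ a → ≤-refl }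

-- Where two codings produce the same tree, the identity program converts between them.
reinterpret : ∀ {A B} (f : Carrier A → Carrier B) → (∀ a → enc A a ≡ enc B (f a)) → A ⇝ B
reinterpret {A} {B} f eq = record
  { fun = f ; term = var zero ; time = con 1 ; space = inp
  ; correct = λ a → 1 , subst (λ v → (enc A a ∷ []) ⊢ var zero ⇓ v ∣ 1) (eq a) (var zero) , ≤-refl
  ; small = λ a → ≤-reflexive (cong size (sym (eq a))) }

infixr 9 _∘ᶜ_
_∘ᶜ_ : ∀ {A B C} → B ⇝ C → A ⇝ B → A ⇝ C
_∘ᶜ_ {A} {B} {C} g f = record
  { fun = fun g ∘ fun f
  ; term = bind (term f) (call (term g))
  ; time = con 1 ⊕ (time f ⊕ time g ⊙ space f)
  ; space = space g ⊙ space f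
  ; correct = λ a → let (t₁ , e₁ , b₁) = correct f a ; (t₂ , e₂ , b₂) = correct g (fun f a) in
      suc (t₁ + t₂) , bind e₁ (call-⇓ e₂) ,
      s≤s (+-mono-≤ b₁ (≤-trans b₂ (⟦⟧ₚ-mono (time g) (small f a))))
  ; small = λ a → ≤-trans (small g (fun f a)) (⟦⟧ₚ-mono (space g) (small f a)) }

infixr 4 _▵_
_▵_ : ∀ {A B C} → A ⇝ B → A ⇝ C → A ⇝ B ⊗ C
f ▵ g = record
  { fun = λ a → fun f a , fun g a
  ; term = node (term f) (term g)
  ; time = con 1 ⊕ (time f ⊕ time g)
  ; space = con 1 ⊕ (space f ⊕ space g)
  ; correct = λ a → let (t₁ , e₁ , b₁) = correct f a ; (t₂ , e₂ , b₂) = correct g a in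
      suc (t₁ + t₂) , node e₁ e₂ , s≤s (+-mono-≤ b₁ b₂)
  ; small = λ a → s≤s (+-mono-≤ (small f a) (small g a)) }

fstᶜ : ∀ {A B} → A ⊗ B ⇝ A
fstᶜ = record
  { fun = proj₁ ; term = case (var zero) leaf (var zero) ; time = con 3 ; space = inp
  ; correct = λ a → 3 , case-node (var zero) (var zero) , ≤-refl
  ; small = λ a → m≤n⇒m≤1+n (m≤m+n _ _) }

sndᶜ : ∀ {A B} → A ⊗ B ⇝ B
sndᶜ = record
  { fun = proj₂ ; term = case (var zero) leaf (var (suc zero)) ; time = con 3 ; space = inp
  ; correct = λ a → 3 , case-node (var zero) (var (suc zero)) , ≤-refl
  ; small = λ a → m≤n⇒m≤1+n (m≤n+m _ _) }

leafᶜ : ∀ {A} B (b : Carrier B) → leaf ≡ enc B b → A ⇝ B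
leafᶜ B b eq = record
  { fun = λ _ → b ; term = leaf ; time = con 1 ; space = con 1
  ; correct = λ a → 1 , subst (λ v → _ ⊢ leaf ⇓ v ∣ 1) eq leaf , ≤-refl
  ; small = λ a → ≤-reflexive (cong size (sym eq)) }

nilᶜ : ∀ {E A} → E ⇝ 𝕃 A
nilᶜ {A = A} = leafᶜ (𝕃 A) [] refl

zeroᶜ : ∀ {E} → E ⇝ ℕᶜ
zeroᶜ = leafᶜ ℕᶜ 0 refl

falseᶜ trueᶜ : ∀ {E} → E ⇝ 𝔹
falseᶜ = leafᶜ 𝔹 false refl
trueᶜ  = record
  { fun = λ _ → true ; term = node leaf leaf ; time = con 3 ; space = con 3
  ; correct = λ a → 3 , node leaf leaf , ≤-refl ; small = λ a → ≤-refl }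

sucᶜ : ℕᶜ ⇝ ℕᶜ
sucᶜ = record
  { fun = suc ; term = node leaf (var zero) ; time = con 3 ; space = con 2 ⊕ inp
  ; correct = λ a → 3 , node leaf (var zero) , ≤-refl ; small = λ a → ≤-refl }

predᶜ : ℕᶜ ⇝ ℕᶜ
predᶜ = record
  { fun = pred ; term = case (var zero) leaf (var (suc zero)) ; time = con 3 ; space = inp
  ; correct = λ { zero → 3 , case-leaf (var zero) leaf , ≤-refl
                ; (suc n) → 3 , case-node (var zero) (var (suc zero)) , ≤-refl }
  ; small = λ { zero → ≤-refl ; (suc n) → m≤n+m _ 2 } }

consᶜ : ∀ {A} → A ⊗ 𝕃 A ⇝ 𝕃 A
consᶜ = reinterpret (λ (x , xs) → x ∷ xs) (λ _ → refl)

ifᶜ : ∀ {E A} → E ⇝ 𝔹 → E ⇝ A → E ⇝ A → E ⇝ A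
ifᶜ {E} {A} c f g = record
  { fun = λ e → if fun c e then fun f e else fun g e
  ; term = case (term c) (term g) (rename (λ _ → suc (suc zero)) (term f))
  ; time = con 1 ⊕ (time c ⊕ (time f ⊕ time g))
  ; space = space f ⊕ space g
  ; correct = run
  ; small = λ e → sm e (fun c e) }
  where
  sm : ∀ e b → size (enc A (if b then fun f e else fun g e)) ≤
       ⟦ space f ⊕ space g ⟧ₚ (size (enc E e))
  sm e false = ≤-trans (small g e) (m≤n+m _ _)
  sm e true  = ≤-trans (small f e) (m≤m+n _ _)

  run : ∀ e → ∃[ t ] (enc E e ∷ []) ⊢ _ ⇓ enc A (if fun c e then fun f e else fun g e) ∣ t × _
  run e with fun c e | correct c e
  ... | false | t₁ , e₁ , b₁ = let (t₂ , e₂ , b₂) = correct g e in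
    suc (t₁ + t₂) , case-leaf e₁ e₂ , s≤s (+-mono-≤ b₁ (≤-trans b₂ (m≤n+m _ _)))
  ... | true | t₁ , e₁ , b₁ = let (t₂ , e₂ , b₂) = correct f e in
    suc (t₁ + t₂) , case-node e₁ (rename-⇓ (λ { zero → refl }) e₂) , s≤s (+-mono-≤ b₁ (≤-trans b₂ (m≤m+n _ _)))

isNil : ∀ {A : Set} → List A → Bool
isNil []      = true
isNil (_ ∷ _) = false

isNilᶜ : ∀ {A} → 𝕃 A ⇝ 𝔹
isNilᶜ = record
  { fun = isNil ; term = case (var zero) (node leaf leaf) leaf ; time = con 5 ; space = con 3
  ; correct = λ { [] → 5 , case-leaf (var zero) (node leaf leaf) , ≤-refl
                ; (_ ∷ _) → 3 , case-node (var zero) leaf , m≤n+m 3 2 }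
  ; small = λ { [] → ≤-refl ; (_ ∷ _) → s≤s z≤n } }

isZero : ℕ → Bool
isZero zero    = true
isZero (suc _) = false

isZeroᶜ : ℕᶜ ⇝ 𝔹
isZeroᶜ = record
  { fun = isZero ; term = case (var zero) (node leaf leaf) leaf ; time = con 5 ; space = con 3
  ; correct = λ { zero → 5 , case-leaf (var zero) (node leaf leaf) , ≤-refl
                ; (suc _) → 3 , case-node (var zero) leaf , m≤n+m 3 2 }
  ; small = λ { zero → ≤-refl ; (suc _) → s≤s z≤n } }

-- The state of the loop is the pair of the accumulator and the remaining list.
foldBody : Term 1 → Term 2
foldBody s =
  case (var zero) leaf
    (case (var (suc zero)) (node leaf (var zero))
      (node (node leaf leaf)
        (node (bind (node (node (var (suc (suc zero))) (var zero)) (var (suc (suc (suc (suc (suc zero)))))))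
                    (call s))
              (var (suc zero)))))

module _ {E B X : Coded} (step : (B ⊗ X) ⊗ E ⇝ B) where

  private
    f : Carrier E → Carrier B → Carrier X → Carrier B
    f e b x = fun step ((b , x) , e)

  -- A bound `M` on the accumulator after every prefix, not only after the last, lets one estimate
  -- of `step` serve for all rounds. A round costs 17 beyond `step`, the closing one costs 8, and
  -- the size of the encoded list exceeds the number of its elements.
  foldBody-⟲ : ∀ e M N b xs → size (encList (enc X) xs) ≤ N →
    (∀ m → size (enc B (foldl (f e) b (take m xs))) ≤ M) →
    ∃[ t ] (enc E e ∷ []) ⊢ foldBody (term step) ⟲ (enc B b ∙ encList (enc X) xs) ⇓ enc B (foldl (f e) b xs) ∣ t ×
      t ≤ 8 + size (encList (enc X) xs) * (17 + ⟦ time step ⟧ₚ (2 + (M + N + size (enc E e))))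
  foldBody-⟲ e M N b [] _ _ =
    8 , stop (case-node (var zero) (case-leaf (var (suc zero)) (node leaf (var zero)))) , m≤m+n 8 _
  foldBody-⟲ e M N b (x ∷ xs) x∷xs≤N acc≤M
    with correct step ((b , x) , e)
       | foldBody-⟲ e M N (f e b x) xs
           (≤-trans (m≤n⇒m≤1+n (m≤n+m _ (size (enc X x)))) x∷xs≤N) (acc≤M ∘ suc)
  ... | t₁ , e₁ , b₁ | t₂ , e₂ , b₂ =
    17 + t₁ + t₂ ,
    subst (λ t → (enc E e ∷ []) ⊢ foldBody (term step) ⟲ (enc B b ∙ enc X x ∙ xsᵗ) ⇓
                   enc B (foldl (f e) (f e b x) xs) ∣ t) steps
      (next (case-node (var zero) (case-node (var (suc zero))
        (node (node leaf leaf)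
          (node (bind (node (node (var (suc (suc zero))) (var zero)) (var (suc (suc (suc (suc (suc zero))))))) (call-⇓ e₁))
                (var (suc zero)))))) e₂) ,
    (begin
      17 + t₁ + t₂                                       ≤⟨ +-mono-≤ (+-monoʳ-≤ 17 (≤-trans b₁ (⟦⟧ₚ-mono (time step) arg))) b₂ ⟩
      W + (8 + size xsᵗ * W)                             ≡⟨ x+[8+y] W (size xsᵗ * W) ⟩
      8 + suc (size xsᵗ) * W                             ≤⟨ +-monoʳ-≤ 8 (*-monoˡ-≤ W (s≤s (m≤n+m (size xsᵗ) (size (enc X x))))) ⟩
      8 + size (enc X x ∙ xsᵗ) * W                      ∎)
    where
    open ≤-Reasoning
    xsᵗ = encList (enc X) xs
    W = 17 + ⟦ time step ⟧ₚ (2 + (M + N + size (enc E e)))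
    x+[8+y] : ∀ x y → x + (8 + y) ≡ 8 + (x + y)
    x+[8+y] x y = trans (sym (+-assoc x 8 y)) (trans (cong (_+ y) (+-comm x 8)) (+-assoc 8 x y))
    arg : suc (suc (size (enc B b) + size (enc X x)) + size (enc E e)) ≤ 2 + (M + N + size (enc E e))
    arg = s≤s (s≤s (+-monoˡ-≤ (size (enc E e)) (+-mono-≤ (acc≤M 0)
            (≤-trans (m≤n⇒m≤1+n (m≤m+n _ _)) x∷xs≤N))))
    steps : suc (suc (1 + suc (1 + suc (3 + suc (suc (5 + t₁) + 1)))) + t₂) ≡ 17 + t₁ + t₂
    steps = cong (λ z → suc (suc (1 + suc (1 + suc (3 + suc z)))) + t₂) (+-comm (6 + t₁) 1)

  -- A polynomial-time step alone does not keep the accumulator polynomial over many rounds, so the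
  -- caller provides `q` for every prefix. On the whole list `q` also bounds the output.
  foldᶜ : (init : E ⇝ B) (list : E ⇝ 𝕃 X) (q : Poly) →
    (∀ e m → size (enc B (foldl (f e) (fun init e) (take m (fun list e)))) ≤ ⟦ q ⟧ₚ (size (enc E e))) →
    E ⇝ B
  foldᶜ init list q acc≤q = record
    { fun = λ e → foldl (f e) (fun init e) (fun list e)
    ; term = loop (node (term init) (term list)) (foldBody (term step))
    ; time = con 2 ⊕ (time init ⊕ time list) ⊕
             (con 8 ⊕ space list ⊛ (con 17 ⊕ time step ⊙ (con 2 ⊕ (q ⊕ space list ⊕ inp))))
    ; space = q
    ; correct = run
    ; small = λ e → subst (λ xs → size (enc B (foldl (f e) (fun init e) xs)) ≤ _)
                          (List.take-all (length (fun list e)) (fun list e) ≤-refl)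
                          (acc≤q e (length (fun list e)))
    }
    where
    run : ∀ e → _
    run e with correct init e | correct list e
             | foldBody-⟲ e (⟦ q ⟧ₚ (size (enc E e))) (⟦ space list ⟧ₚ (size (enc E e)))
                 (fun init e) (fun list e) (small list e) (acc≤q e)
    ... | t₁ , e₁ , b₁ | t₂ , e₂ , b₂ | t₃ , e₃ , b₃ =
      suc (suc (t₁ + t₂) + t₃) , loop (node e₁ e₂) e₃ ,
      s≤s (+-mono-≤ (s≤s (+-mono-≤ b₁ b₂)) (≤-trans b₃ (+-monoʳ-≤ 8 (*-monoˡ-≤ _ (small list e)))))

  foldl-growth : ∀ e N G b xs → size (encList (enc X) xs) ≤ N →
    (∀ b x → size (enc X x) ≤ N → size (enc B (f e b x)) ≤ size (enc B b) + G) →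
    ∀ m → size (enc B (foldl (f e) b (take m xs))) ≤ size (enc B b) + size (encList (enc X) xs) * G
  foldl-growth e N G b xs       _      _    zero    = m≤m+n _ _
  foldl-growth e N G b []       _      _    (suc m) = m≤m+n _ _
  foldl-growth e N G b (x ∷ xs) x∷xs≤N grow (suc m) = begin
    size (enc B (foldl (f e) (f e b x) (take m xs)))    ≤⟨ foldl-growth e N G (f e b x) xs (≤-trans (m≤n⇒m≤1+n (m≤n+m _ (size (enc X x)))) x∷xs≤N) grow m ⟩
    size (enc B (f e b x)) + size xsᵗ * G               ≤⟨ +-monoˡ-≤ _ (grow b x (≤-trans (m≤n⇒m≤1+n (m≤m+n _ _)) x∷xs≤N)) ⟩
    size (enc B b) + G + size xsᵗ * G                   ≡⟨ +-assoc (size (enc B b)) G _ ⟩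
    size (enc B b) + suc (size xsᵗ) * G                 ≤⟨ +-monoʳ-≤ (size (enc B b)) (*-monoˡ-≤ G (s≤s (m≤n+m _ (size (enc X x))))) ⟩
    size (enc B b) + size (enc X x ∙ xsᵗ) * G          ∎
    where
    open ≤-Reasoning
    xsᵗ = encList (enc X) xs

  -- The usual source of `q`: if a round enlarges the accumulator by an amount that depends on the
  -- element and the environment only, the total growth is at most that amount times the size of the
  -- list.
  foldᶜ-additive : (init : E ⇝ B) (list : E ⇝ 𝕃 X) (g : Poly) →
    (∀ e b x → size (enc B (f e b x)) ≤ size (enc B b) + ⟦ g ⟧ₚ (size (enc X x) + size (enc E e))) →
    E ⇝ B
  foldᶜ-additive init list g grow =
    foldᶜ init list (space init ⊕ space list ⊛ g ⊙ (space list ⊕ inp)) λ e m →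
      ≤-trans (foldl-growth e (⟦ space list ⟧ₚ (size (enc E e))) _ (fun init e) (fun list e) (small list e)
                 (λ b x x≤ → ≤-trans (grow e b x) (+-monoʳ-≤ _ (⟦⟧ₚ-mono g (+-monoˡ-≤ _ x≤)))) m)
              (+-mono-≤ (small init e) (*-monoˡ-≤ _ (small list e)))

-- Lists and arithmetic

private
  variable
    A B C E X Y : Coded

revAppendᶜ : E ⇝ 𝕃 A → E ⇝ 𝕃 A → E ⇝ 𝕃 A
revAppendᶜ {A = A} xs ys = foldᶜ-additive (consᶜ ∘ᶜ (sndᶜ ▵ fstᶜ) ∘ᶜ fstᶜ) ys xs (con 1 ⊕ inp) λ e b x →
  ≤-trans (≤-reflexive (trans (cong suc (+-comm (size (enc A x)) _)) (sym (+-suc _ (size (enc A x))))))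
          (+-monoʳ-≤ _ (s≤s (m≤m+n _ _)))

reverseᶜ : 𝕃 A ⇝ 𝕃 A
reverseᶜ = revAppendᶜ idᶜ nilᶜ

size-ʳ++ : ∀ {A : Set} (f : A → Tree) xs ys →
  size (encList f (xs ʳ++ ys)) ≤ size (encList f ys) + size (encList f xs)
size-ʳ++ f []       ys = m≤m+n _ 1
size-ʳ++ f (x ∷ xs) ys = begin
  size (encList f (xs ʳ++ x ∷ ys))                ≤⟨ size-ʳ++ f xs (x ∷ ys) ⟩
  suc (size (f x) + size (encList f ys)) + size (encList f xs)
    ≡⟨ cong (λ z → suc z + size (encList f xs)) (+-comm (size (f x)) _) ⟩
  suc (size (encList f ys) + size (f x) + size (encList f xs))
    ≡⟨ cong suc (+-assoc (size (encList f ys)) _ _) ⟩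
  suc (size (encList f ys) + (size (f x) + size (encList f xs)))
    ≡⟨ +-suc _ _ ⟨
  size (encList f ys) + suc (size (f x) + size (encList f xs)) ∎
  where open ≤-Reasoning

foldl-ʳ++ : ∀ {A B : Set} (f : A → List B) ys xs →
  foldl (λ acc x → f x ʳ++ acc) ys xs ≡ concatMap f xs ʳ++ ys
foldl-ʳ++ f ys []       = refl
foldl-ʳ++ f ys (x ∷ xs) = trans (foldl-ʳ++ f (f x ʳ++ ys) xs) (sym (List.++-ʳ++ (f x)))

-- Each block is prepended in reverse, so it adds only its own size to the accumulator, and one
-- reversal at the end restores the order.
concatMapᶜ : X ⊗ E ⇝ 𝕃 Y → E ⇝ 𝕃 X → E ⇝ 𝕃 Y
concatMapᶜ {X = X} {Y = Y} body list =
  with-fun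
    (reverseᶜ ∘ᶜ foldᶜ-additive (revAppendᶜ (body ∘ᶜ ((sndᶜ ∘ᶜ fstᶜ) ▵ sndᶜ)) (fstᶜ ∘ᶜ fstᶜ)) nilᶜ list
       (space body ⊙ (con 1 ⊕ inp))
       λ e b x → ≤-trans (size-ʳ++ (enc Y) (fun body (x , e)) b) (+-monoʳ-≤ _ (small body (x , e))))
    (λ e → concatMap (λ x → fun body (x , e)) (fun list e))
    λ e → trans (cong reverse (foldl-ʳ++ (λ x → fun body (x , e)) [] (fun list e)))
                (List.reverse-involutive (concatMap (λ x → fun body (x , e)) (fun list e)))

concatMap-[_] : ∀ {A B : Set} (f : A → B) xs → concatMap ([_] ∘ f) xs ≡ map f xs
concatMap-[ f ] []       = refl
concatMap-[ f ] (x ∷ xs) = cong (f x ∷_) (concatMap-[ f ] xs)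

mapᶜ : X ⊗ E ⇝ Y → E ⇝ 𝕃 X → E ⇝ 𝕃 Y
mapᶜ body list =
  with-fun (concatMapᶜ (consᶜ ∘ᶜ (body ▵ nilᶜ)) list)
    (λ e → map (λ x → fun body (x , e)) (fun list e))
    (λ e → concatMap-[ (λ x → fun body (x , e)) ] (fun list e))

concatMap-cartesian : ∀ {A B C : Set} (f : A → B → C) xs ys →
  concatMap (λ x → map (f x) ys) xs ≡ cartesianProductWith f xs ys
concatMap-cartesian f []       ys = refl
concatMap-cartesian f (x ∷ xs) ys = cong (map (f x) ys ++_) (concatMap-cartesian f xs ys)

cartesianProductWithᶜ : A ⊗ B ⇝ C → E ⇝ 𝕃 A → E ⇝ 𝕃 B → E ⇝ 𝕃 C
cartesianProductWithᶜ f xs ys =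
  with-fun (concatMapᶜ (mapᶜ (f ∘ᶜ ((fstᶜ ∘ᶜ sndᶜ) ▵ fstᶜ)) (ys ∘ᶜ sndᶜ)) xs)
    (λ e → cartesianProductWith (λ a b → fun f (a , b)) (fun xs e) (fun ys e))
    (λ e → concatMap-cartesian (λ a b → fun f (a , b)) (fun xs e) (fun ys e))

appendᶜ : E ⇝ 𝕃 A → E ⇝ 𝕃 A → E ⇝ 𝕃 A
appendᶜ xs ys = with-fun (revAppendᶜ (reverseᶜ ∘ᶜ xs) ys) (λ e → fun xs e ++ fun ys e)
  λ e → trans (List.ʳ++-defn (reverse (fun xs e))) (cong (_++ fun ys e) (List.reverse-involutive (fun xs e)))

notᶜ : 𝔹 ⇝ 𝔹
notᶜ = with-fun (ifᶜ idᶜ falseᶜ trueᶜ) not λ { false → refl ; true → refl }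

infixr 6 _∧ᶜ_
infixr 5 _∨ᶜ_
_∧ᶜ_ _∨ᶜ_ : E ⇝ 𝔹 → E ⇝ 𝔹 → E ⇝ 𝔹
c ∧ᶜ d = with-fun (ifᶜ c d falseᶜ) (λ e → fun c e ∧ fun d e) λ e → lemma (fun c e)
  where lemma : ∀ b {b′} → (if b then b′ else false) ≡ b ∧ b′
        lemma false = refl
        lemma true  = refl
c ∨ᶜ d = with-fun (ifᶜ c trueᶜ d) (λ e → fun c e ∨ fun d e) λ e → lemma (fun c e)
  where lemma : ∀ b {b′} → (if b then true else b′) ≡ b ∨ b′
        lemma false = refl
        lemma true  = refl

anyᶜ : X ⊗ E ⇝ 𝔹 → E ⇝ 𝕃 X → E ⇝ 𝔹
anyᶜ p list =
  with-fun (notᶜ ∘ᶜ isNilᶜ ∘ᶜ concatMapᶜ (ifᶜ p (consᶜ ∘ᶜ (falseᶜ ▵ nilᶜ)) nilᶜ) list)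
    (λ e → any (λ x → fun p (x , e)) (fun list e))
    (λ e → lemma (λ x → fun p (x , e)) (fun list e))
  where
  lemma : ∀ {A : Set} (p : A → Bool) xs →
    not (isNil (concatMap (λ x → if p x then [ false ] else []) xs)) ≡ any p xs
  lemma p []       = refl
  lemma p (x ∷ xs) with p x
  ... | true  = refl
  ... | false = lemma p xs

allᶜ : X ⊗ E ⇝ 𝔹 → E ⇝ 𝕃 X → E ⇝ 𝔹
allᶜ p list =
  with-fun (notᶜ ∘ᶜ anyᶜ (notᶜ ∘ᶜ p) list)
    (λ e → all (λ x → fun p (x , e)) (fun list e))
    (λ e → lemma (λ x → fun p (x , e)) (fun list e))
  where
  lemma : ∀ {A : Set} (p : A → Bool) xs → not (any (not ∘ p) xs) ≡ all p xs
  lemma p []       = refl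
  lemma p (x ∷ xs) with p x
  ... | true  = lemma p xs
  ... | false = refl

-- Numerals and lists of units have identical codes, so recursion on a number becomes a fold over a
-- list.
unary : ℕ → List ⊤
unary n = replicate n tt

𝟙 : Coded
𝟙 = coded ⊤ λ _ → leaf

take-unary : ∀ m n → take m (unary n) ≡ unary (m ⊓ n)
take-unary zero    n       = refl
take-unary (suc m) zero    = refl
take-unary (suc m) (suc n) = cong (tt ∷_) (take-unary m n)

length-cartesian : ∀ {A B C : Set} {f : A → B → C} xs ys →
  length (cartesianProductWith f xs ys) ≡ length xs * length ys
length-cartesian         []       ys = refl
length-cartesian {f = f} (x ∷ xs) ys =
  trans (List.length-++ (map (f x) ys)) (cong₂ _+_ (List.length-map (f x) ys) (length-cartesian xs ys))

unaryᶜ : ℕᶜ ⇝ 𝕃 𝟙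
unaryᶜ = reinterpret unary lemma
  where lemma : ∀ n → encℕ n ≡ encList (λ _ → leaf) (unary n)
        lemma zero    = refl
        lemma (suc n) = cong (leaf ∙_) (lemma n)

lengthᶜ : 𝕃 A ⇝ ℕᶜ
lengthᶜ = with-fun
  (foldᶜ-additive (sucᶜ ∘ᶜ fstᶜ ∘ᶜ fstᶜ) zeroᶜ idᶜ (con 2) λ e b x → ≤-reflexive (+-comm 2 _))
  length (lemma 0)
  where
  lemma : ∀ {A : Set} n (xs : List A) → foldl (λ b x → suc b) n xs ≡ n + length xs
  lemma n []       = sym (+-identityʳ n)
  lemma n (x ∷ xs) = trans (lemma (suc n) xs) (sym (+-suc n (length xs)))

infixl 5 _∸ᶜ_ _+ᶜ_
infixl 6 _*ᶜ_
infix 4 _<ᶜ_ _≡ᶜ_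

_∸ᶜ_ _+ᶜ_ _*ᶜ_ : E ⇝ ℕᶜ → E ⇝ ℕᶜ → E ⇝ ℕᶜ
m ∸ᶜ n = with-fun
  (foldᶜ-additive (predᶜ ∘ᶜ fstᶜ ∘ᶜ fstᶜ) m (unaryᶜ ∘ᶜ n) (con 0) λ e b x → grow b)
  (λ e → fun m e ∸ fun n e) λ e → lemma (fun m e) (fun n e)
  where
  grow : ∀ b → size (encℕ (pred b)) ≤ size (encℕ b) + 0
  grow zero    = s≤s z≤n
  grow (suc b) = m≤n⇒m≤1+n (m≤n⇒m≤1+n (m≤m+n _ 0))
  lemma : ∀ m n → foldl (λ b x → pred b) m (unary n) ≡ m ∸ n
  lemma m       zero    = refl
  lemma zero    (suc n) = trans (lemma 0 n) (0∸n≡0 n)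
  lemma (suc m) (suc n) = lemma m n
m +ᶜ n = with-fun
  (lengthᶜ ∘ᶜ appendᶜ (unaryᶜ ∘ᶜ m) (unaryᶜ ∘ᶜ n))
  (λ e → fun m e + fun n e)
  (λ e → trans (List.length-++ (unary (fun m e)))
               (cong₂ _+_ (List.length-replicate (fun m e)) (List.length-replicate (fun n e))))
m *ᶜ n = with-fun
  -- In unary a product is the length of a Cartesian product.
  (lengthᶜ ∘ᶜ cartesianProductWithᶜ fstᶜ (unaryᶜ ∘ᶜ m) (unaryᶜ ∘ᶜ n))
  (λ e → fun m e * fun n e)
  (λ e → trans (length-cartesian (unary (fun m e)) (unary (fun n e)))
               (cong₂ _*_ (List.length-replicate (fun m e)) (List.length-replicate (fun n e))))

_^ᶜ_ : E ⇝ ℕᶜ → ℕ → E ⇝ ℕᶜ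
m ^ᶜ zero  = sucᶜ ∘ᶜ zeroᶜ
m ^ᶜ suc d = m *ᶜ m ^ᶜ d

fun-^ᶜ : ∀ (m : E ⇝ ℕᶜ) d e → fun (m ^ᶜ d) e ≡ fun m e ^ d
fun-^ᶜ m zero    e = refl
fun-^ᶜ m (suc d) e = cong (fun m e *_) (fun-^ᶜ m d e)

constᶜ : ℕ → E ⇝ ℕᶜ
constᶜ zero    = zeroᶜ
constᶜ (suc n) = sucᶜ ∘ᶜ constᶜ n

fun-constᶜ : ∀ n (e : Carrier E) → fun (constᶜ {E} n) e ≡ n
fun-constᶜ zero        e = refl
fun-constᶜ {E} (suc n) e = cong suc (fun-constᶜ {E} n e)

_<ᶜ_ _≡ᶜ_ : E ⇝ ℕᶜ → E ⇝ ℕᶜ → E ⇝ 𝔹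
m <ᶜ n = with-fun (notᶜ ∘ᶜ isZeroᶜ ∘ᶜ (n ∸ᶜ m)) (λ e → fun m e <ᵇ fun n e) λ e → lemma (fun m e) (fun n e)
  where
  lemma : ∀ m n → not (isZero (n ∸ m)) ≡ (m <ᵇ n)
  lemma zero    zero    = refl
  lemma zero    (suc n) = refl
  lemma (suc m) zero    = refl
  lemma (suc m) (suc n) = lemma m n
m ≡ᶜ n = with-fun (isZeroᶜ ∘ᶜ (m ∸ᶜ n) ∧ᶜ isZeroᶜ ∘ᶜ (n ∸ᶜ m)) (λ e → fun m e ≡ᵇ fun n e) λ e → lemma (fun m e) (fun n e)
  where
  lemma : ∀ m n → isZero (m ∸ n) ∧ isZero (n ∸ m) ≡ (m ≡ᵇ n)
  lemma zero    zero    = refl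
  lemma zero    (suc n) = refl
  lemma (suc m) zero    = refl
  lemma (suc m) (suc n) = lemma m n

-- After m rounds the accumulator is `downFrom m`, whose length is the next entry. The growth thus
-- depends on the accumulator itself, which `foldᶜ-additive` does not allow; a quadratic bound is
-- proved directly instead.
downFromᶜ : ℕᶜ ⇝ 𝕃 ℕᶜ
downFromᶜ = with-fun
  (foldᶜ (consᶜ ∘ᶜ ((lengthᶜ ∘ᶜ fstᶜ ∘ᶜ fstᶜ) ▵ (fstᶜ ∘ᶜ fstᶜ))) nilᶜ unaryᶜ (con 1 ⊕ (inp ⊕ con 1) ⊛ inp) bounded)
  downFrom λ n → trans (result n 0) (cong downFrom (+-identityʳ n))
  where
  step : List ℕ → ⊤ → List ℕ
  step acc _ = length acc ∷ acc

  result : ∀ n m → foldl step (downFrom m) (unary n) ≡ downFrom (n + m)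
  result zero    m = refl
  result (suc n) m rewrite List.length-downFrom m = trans (result n (suc m)) (cong downFrom (+-suc n m))

  unary-size : ∀ n → n ≤ size (encℕ n)
  unary-size zero    = z≤n
  unary-size (suc n) = s≤s (m≤n⇒m≤1+n (unary-size n))

  encℕ-size : ∀ {m n} → m ≤ n → size (encℕ m) ≤ size (encℕ n)
  encℕ-size {n = zero}  z≤n     = ≤-refl
  encℕ-size {n = suc n} z≤n     = s≤s z≤n
  encℕ-size             (s≤s h) = s≤s (s≤s (encℕ-size h))

  downFrom-size : ∀ n m → m ≤ n → size (encList encℕ (downFrom m)) ≤ 1 + m * suc (size (encℕ n))
  downFrom-size n zero    m≤n = ≤-refl
  downFrom-size n (suc m) m<n = s≤s (≤-trans (+-mono-≤ (encℕ-size (<⇒≤ m<n)) (downFrom-size n m (<⇒≤ m<n)))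
                                             (≤-reflexive (+-suc (size (encℕ n)) _)))

  bounded : ∀ n m → size (encList encℕ (foldl step [] (take m (unary n)))) ≤
            1 + (size (encℕ n) + 1) * size (encℕ n)
  bounded n m = begin
    size (encList encℕ (foldl step [] (take m (unary n))))
      ≡⟨ cong (λ xs → size (encList encℕ (foldl step [] xs))) (take-unary m n) ⟩
    size (encList encℕ (foldl step [] (unary (m ⊓ n))))
      ≡⟨ cong (size ∘ encList encℕ) (trans (result (m ⊓ n) 0) (cong downFrom (+-identityʳ (m ⊓ n)))) ⟩
    size (encList encℕ (downFrom (m ⊓ n)))
      ≤⟨ downFrom-size n (m ⊓ n) (m⊓n≤n m n) ⟩
    1 + (m ⊓ n) * suc (size (encℕ n))
      ≤⟨ s≤s (*-monoˡ-≤ _ (≤-trans (m⊓n≤n m n) (unary-size n))) ⟩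
    1 + size (encℕ n) * suc (size (encℕ n))
      ≡⟨ cong suc (trans (*-comm (size (encℕ n)) _) (cong (_* size (encℕ n)) (+-comm 1 (size (encℕ n))))) ⟩
    1 + (size (encℕ n) + 1) * size (encℕ n) ∎
    where open ≤-Reasoning

headᶜ : ∀ {n} → 𝕍 A (suc n) ⇝ A
headᶜ {A = A} = with-fun (fstᶜ ∘ᶜ reinterpret {B = A ⊗ 𝕍 A _} (λ { (x ∷ xs) → x , xs }) λ { (x ∷ xs) → refl })
  Vec.head λ { (x ∷ xs) → refl }

tailᶜ : ∀ {n} → 𝕍 A (suc n) ⇝ 𝕍 A n
tailᶜ {A = A} = with-fun (sndᶜ ∘ᶜ reinterpret {B = A ⊗ 𝕍 A _} (λ { (x ∷ xs) → x , xs }) λ { (x ∷ xs) → refl })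
  Vec.tail λ { (x ∷ xs) → refl }

toListᶜ : ∀ {n} → 𝕍 A n ⇝ 𝕃 A
toListᶜ = reinterpret Vec.toList λ _ → refl

vconsᶜ : ∀ {n} → A ⊗ 𝕍 A n ⇝ 𝕍 A (suc n)
vconsᶜ = reinterpret (λ (x , xs) → x ∷ xs) λ _ → refl

-- The reduction

-- (i , a , b) says that the i-th true position is a and that the next one is b.
Triple : Set
Triple = ℕ × ℕ × ℕ

𝕋 : Coded
𝕋 = ℕᶜ ⊗ ℕᶜ ⊗ ℕᶜ

Input : Set
Input = (ℕ × List (List (Bool × ℕ))) × ℕ

𝕀 : Coded
𝕀 = (ℕᶜ ⊗ 𝕃 (𝕃 (𝔹 ⊗ ℕᶜ))) ⊗ ℕᶜ

-- In order: the first triple is not increasing, slot 0 does not start at the sentinel 0, slot k + 1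
-- does not start at the sentinel n + 1, one slot is read in two ways, or consecutive slots do not
-- chain.
clash : ℕ → ℕ → Triple → Triple → Bool
clash n k (i , a , b) (j , c , d) =
  not (a <ᵇ b) ∨
  (i ≡ᵇ 0) ∧ not (a ≡ᵇ 0) ∨
  (i ≡ᵇ suc k) ∧ not (a ≡ᵇ suc n) ∨
  (i ≡ᵇ j) ∧ not ((a ≡ᵇ c) ∧ (b ≡ᵇ d)) ∨
  (suc i ≡ᵇ j) ∧ not (b ≡ᵇ c)

clashᶜ : E ⇝ ℕᶜ → E ⇝ ℕᶜ → E ⇝ 𝕋 → E ⇝ 𝕋 → E ⇝ 𝔹
clashᶜ n k t t′ =
  notᶜ ∘ᶜ (a <ᶜ b) ∨ᶜ
  (i ≡ᶜ zeroᶜ) ∧ᶜ notᶜ ∘ᶜ (a ≡ᶜ zeroᶜ) ∨ᶜ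
  (i ≡ᶜ sucᶜ ∘ᶜ k) ∧ᶜ notᶜ ∘ᶜ (a ≡ᶜ sucᶜ ∘ᶜ n) ∨ᶜ
  (i ≡ᶜ j) ∧ᶜ notᶜ ∘ᶜ ((a ≡ᶜ c) ∧ᶜ (b ≡ᶜ d)) ∨ᶜ
  (sucᶜ ∘ᶜ i ≡ᶜ j) ∧ᶜ notᶜ ∘ᶜ (b ≡ᶜ c)
  where
  i = fstᶜ ∘ᶜ t
  a = fstᶜ ∘ᶜ sndᶜ ∘ᶜ t
  b = sndᶜ ∘ᶜ sndᶜ ∘ᶜ t
  j = fstᶜ ∘ᶜ t′
  c = fstᶜ ∘ᶜ sndᶜ ∘ᶜ t′
  d = sndᶜ ∘ᶜ sndᶜ ∘ᶜ t′

-- Variable v sits at position v + 1.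
falsifies : Bool × ℕ → Triple → Bool
falsifies (s , v) (i , a , b) = if s then (a <ᵇ suc v) ∧ (suc v <ᵇ b) else (a ≡ᵇ suc v)

falsifiesᶜ : E ⇝ 𝔹 ⊗ ℕᶜ → E ⇝ 𝕋 → E ⇝ 𝔹
falsifiesᶜ l t = ifᶜ (fstᶜ ∘ᶜ l) ((a <ᶜ v) ∧ᶜ (v <ᶜ b)) (a ≡ᶜ v)
  where
  v = sucᶜ ∘ᶜ sndᶜ ∘ᶜ l
  a = fstᶜ ∘ᶜ sndᶜ ∘ᶜ t
  b = sndᶜ ∘ᶜ sndᶜ ∘ᶜ t

-- Running over all ordered pairs, each triple with itself included, covers the conditions that
-- `clash` puts on its first triple alone and the chaining condition in both directions.
bad : Input → List Triple → Bool
bad ((n , φ) , k) w =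
  any (λ t → any (λ t′ → clash n k t t′) w) w ∨
  any (λ C → all (λ l → any (λ t → falsifies l t) w) C) φ

badᶜ : 𝕃 𝕋 ⊗ 𝕀 ⇝ 𝔹
badᶜ = with-fun
  (anyᶜ (anyᶜ (clashᶜ (fstᶜ ∘ᶜ fstᶜ ∘ᶜ sndᶜ ∘ᶜ sndᶜ ∘ᶜ sndᶜ) (sndᶜ ∘ᶜ sndᶜ ∘ᶜ sndᶜ ∘ᶜ sndᶜ) (fstᶜ ∘ᶜ sndᶜ) fstᶜ)
              (fstᶜ ∘ᶜ sndᶜ)) fstᶜ
   ∨ᶜ
   anyᶜ (allᶜ (anyᶜ (falsifiesᶜ (fstᶜ ∘ᶜ sndᶜ) fstᶜ) (fstᶜ ∘ᶜ sndᶜ ∘ᶜ sndᶜ)) fstᶜ) (sndᶜ ∘ᶜ fstᶜ ∘ᶜ sndᶜ))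
  (λ (w , x) → bad x w) λ _ → refl

sameTriple : Triple → Triple → Bool
sameTriple (i , a , b) (j , c , d) = (i ≡ᵇ j) ∧ (a ≡ᵇ c) ∧ (b ≡ᵇ d)

sameTripleᶜ : E ⇝ 𝕋 → E ⇝ 𝕋 → E ⇝ 𝔹
sameTripleᶜ t t′ = (fstᶜ ∘ᶜ t ≡ᶜ fstᶜ ∘ᶜ t′) ∧ᶜ (fstᶜ ∘ᶜ sndᶜ ∘ᶜ t ≡ᶜ fstᶜ ∘ᶜ sndᶜ ∘ᶜ t′)
                 ∧ᶜ (sndᶜ ∘ᶜ sndᶜ ∘ᶜ t ≡ᶜ sndᶜ ∘ᶜ sndᶜ ∘ᶜ t′)

same : ∀ {D} → Vec Triple D → Vec Triple D → Bool
same []       []       = true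
same (t ∷ ts) (u ∷ us) = sameTriple t u ∧ same ts us

same′ᶜ : ∀ D → 𝕍 𝕋 D ⊗ 𝕍 𝕋 D ⇝ 𝔹
same′ᶜ zero    = trueᶜ
same′ᶜ (suc D) =
  sameTripleᶜ (headᶜ ∘ᶜ fstᶜ) (headᶜ ∘ᶜ sndᶜ) ∧ᶜ same′ᶜ D ∘ᶜ (tailᶜ ∘ᶜ fstᶜ ▵ tailᶜ ∘ᶜ sndᶜ)

fun-same′ᶜ : ∀ D ts us → fun (same′ᶜ D) (ts , us) ≡ same ts us
fun-same′ᶜ zero    []       []       = refl
fun-same′ᶜ (suc D) (t ∷ ts) (u ∷ us) = cong (sameTriple t u ∧_) (fun-same′ᶜ D ts us)

sameᶜ : ∀ D → 𝕍 𝕋 D ⊗ 𝕍 𝕋 D ⇝ 𝔹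
sameᶜ D = with-fun (same′ᶜ D) (λ (ts , us) → same ts us) λ (ts , us) → fun-same′ᶜ D ts us

-- Testing both orders of concatenation makes symmetry an instance of commutativity of `_∨_`.
adjacent : Input → ∀ {D} → Vec Triple D → Vec Triple D → Bool
adjacent x ts us = not (same ts us) ∧
  (bad x (Vec.toList ts ++ Vec.toList us) ∨ bad x (Vec.toList us ++ Vec.toList ts))

adjacentᶜ : ∀ D → 𝕍 𝕋 D ⊗ 𝕍 𝕋 D ⊗ 𝕀 ⇝ 𝔹
adjacentᶜ D = with-fun
  (notᶜ ∘ᶜ sameᶜ D ∘ᶜ (us ▵ vs) ∧ᶜ
   (badᶜ ∘ᶜ (appendᶜ (toListᶜ ∘ᶜ us) (toListᶜ ∘ᶜ vs) ▵ x) ∨ᶜ badᶜ ∘ᶜ (appendᶜ (toListᶜ ∘ᶜ vs) (toListᶜ ∘ᶜ us) ▵ x)))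
  (λ (us , vs , x) → adjacent x us vs) (λ _ → refl)
  where
  us = fstᶜ
  vs = fstᶜ ∘ᶜ sndᶜ
  x  = sndᶜ ∘ᶜ sndᶜ
-- The number with base-`S` digits `I`, least significant digit first.
value : ℕ → ∀ {D} → Vec ℕ D → ℕ
value S []      = 0
value S (i ∷ I) = i + S * value S I

class : ℕ → ∀ {D} → Vec Triple D → ℕ
class S ts = value S (Vec.map proj₁ ts)

class′ᶜ : ∀ D → 𝕍 𝕋 D ⊗ ℕᶜ ⇝ ℕᶜ
class′ᶜ zero    = zeroᶜ
class′ᶜ (suc D) = fstᶜ ∘ᶜ headᶜ ∘ᶜ fstᶜ +ᶜ sndᶜ *ᶜ class′ᶜ D ∘ᶜ (tailᶜ ∘ᶜ fstᶜ ▵ sndᶜ)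

fun-class′ᶜ : ∀ D ts S → fun (class′ᶜ D) (ts , S) ≡ class S ts
fun-class′ᶜ zero    []             S = refl
fun-class′ᶜ (suc D) ((i , _) ∷ ts) S = cong (λ c → i + S * c) (fun-class′ᶜ D ts S)

classᶜ : ∀ D → 𝕍 𝕋 D ⊗ ℕᶜ ⇝ ℕᶜ
classᶜ D = with-fun (class′ᶜ D) (λ (ts , S) → class S ts) λ (ts , S) → fun-class′ᶜ D ts S

triples : ℕ → ℕ → List Triple
triples S V = cartesianProductWith _,_ (downFrom S) (cartesianProductWith _,_ (downFrom V) (downFrom V))

triplesᶜ : ℕᶜ ⊗ ℕᶜ ⇝ 𝕃 𝕋
triplesᶜ = with-fun
  (cartesianProductWithᶜ idᶜ (downFromᶜ ∘ᶜ fstᶜ) (cartesianProductWithᶜ idᶜ (downFromᶜ ∘ᶜ sndᶜ) (downFromᶜ ∘ᶜ sndᶜ)))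
  (λ (S , V) → triples S V) λ _ → refl

tuples : ∀ {A : Set} D → List A → List (Vec A D)
tuples zero    xs = [] ∷ []
tuples (suc D) xs = cartesianProductWith _∷_ xs (tuples D xs)

tuples′ᶜ : ∀ D → 𝕃 A ⇝ 𝕃 (𝕍 A D)
tuples′ᶜ {A} zero    = consᶜ ∘ᶜ (leafᶜ (𝕍 A 0) [] refl ▵ nilᶜ)
tuples′ᶜ     (suc D) = cartesianProductWithᶜ vconsᶜ idᶜ (tuples′ᶜ D)

fun-tuples′ᶜ : ∀ D xs → fun (tuples′ᶜ {A} D) xs ≡ tuples D xs
fun-tuples′ᶜ     zero    xs = refl
fun-tuples′ᶜ {A} (suc D) xs = cong (cartesianProductWith _∷_ xs) (fun-tuples′ᶜ {A} D xs)

tuplesᶜ : ∀ D → 𝕃 A ⇝ 𝕃 (𝕍 A D)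
tuplesᶜ {A} D = with-fun (tuples′ᶜ D) (tuples D) (fun-tuples′ᶜ {A} D)

-- Slots run through 0, ..., k + 1 and positions through 0, ..., n + 2, all sentinels included.
slots values : Input → ℕ
slots  (_ , k)       = 2 + k
values ((n , _) , _) = 3 + n

vertices : ∀ D → Input → List (Vec Triple D)
vertices D x = tuples D (triples (slots x) (values x))

slotsᶜ valuesᶜ : 𝕀 ⇝ ℕᶜ
slotsᶜ  = sucᶜ ∘ᶜ sucᶜ ∘ᶜ sndᶜ
valuesᶜ = sucᶜ ∘ᶜ sucᶜ ∘ᶜ sucᶜ ∘ᶜ fstᶜ ∘ᶜ fstᶜ

verticesᶜ : ∀ D → 𝕀 ⇝ 𝕃 (𝕍 𝕋 D)
verticesᶜ D = tuplesᶜ D ∘ᶜ triplesᶜ ∘ᶜ (slotsᶜ ▵ valuesᶜ)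

𝕆 : Coded
𝕆 = (𝕃 (𝕃 𝔹) ⊗ 𝕃 ℕᶜ ⊗ ℕᶜ) ⊗ ℕᶜ

-- The bound on the cover is what remains of the vertices when one is left out of each of the
-- `slots x ^ D` cliques.
reduction : ∀ D → Input → Carrier 𝕆
reduction D x =
  (map (λ u → map (adjacent x u) (vertices D x)) (vertices D x) ,
   map (class (slots x)) (vertices D x) ,
   length (vertices D x) ∸ slots x ^ D) ,
  slots x ^ D

reductionᶜ : ∀ D → 𝕀 ⇝ 𝕆
reductionᶜ D = with-fun
  ((mapᶜ (mapᶜ (adjacentᶜ D ∘ᶜ (fstᶜ ∘ᶜ sndᶜ ▵ fstᶜ ▵ sndᶜ ∘ᶜ sndᶜ)) (verticesᶜ D ∘ᶜ sndᶜ)) (verticesᶜ D) ▵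
    mapᶜ (classᶜ D ∘ᶜ (fstᶜ ▵ slotsᶜ ∘ᶜ sndᶜ)) (verticesᶜ D) ▵
    (lengthᶜ ∘ᶜ verticesᶜ D ∸ᶜ classesᶜ)) ▵
   classesᶜ)
  (reduction D) λ _ → refl
  where
  classesᶜ : 𝕀 ⇝ ℕᶜ
  classesᶜ = with-fun (slotsᶜ ^ᶜ D) (λ x → slots x ^ D) (fun-^ᶜ slotsᶜ D)

-- Finite sets

enum : ∀ {n} (S : Subset n) → Fin ∣ S ∣ → Fin n
enum (true  ∷ S) zero    = zero
enum (true  ∷ S) (suc i) = suc (enum S i)
enum (false ∷ S) i       = suc (enum S i)

enum-∈ : ∀ {n} (S : Subset n) i → enum S i ∈ S
enum-∈ (true  ∷ S) zero    = Vec.here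
enum-∈ (true  ∷ S) (suc i) = Vec.there (enum-∈ S i)
enum-∈ (false ∷ S) i       = Vec.there (enum-∈ S i)

enum-injective : ∀ {n} (S : Subset n) {i j} → enum S i ≡ enum S j → i ≡ j
enum-injective (true  ∷ S) {zero}  {zero}  eq = refl
enum-injective (true  ∷ S) {suc i} {suc j} eq = cong suc (enum-injective S (Fin.suc-injective eq))
enum-injective (false ∷ S) eq = enum-injective S (Fin.suc-injective eq)

enum-surjective : ∀ {n} (S : Subset n) {v} → v ∈ S → ∃[ i ] enum S i ≡ v
enum-surjective (true  ∷ S) Vec.here = zero , refl
enum-surjective (true  ∷ S) (Vec.there v∈S) = let (i , eq) = enum-surjective S v∈S in suc i , cong suc eq
enum-surjective (false ∷ S) (Vec.there v∈S) = let (i , eq) = enum-surjective S v∈S in i , cong suc eq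

injective⇒≤∣∣ : ∀ {m n} (S : Subset n) (f : Fin m → Fin n) →
  (∀ i → f i ∈ S) → (∀ {i j} → f i ≡ f j → i ≡ j) → m ≤ ∣ S ∣
injective⇒≤∣∣ S f f∈S inj = Fin.injective⇒≤ {f = λ i → proj₁ (index i)} λ {i} {j} eq →
  inj (trans (sym (proj₂ (index i))) (trans (cong (enum S) eq) (proj₂ (index j))))
  where index = λ i → enum-surjective S (f∈S i)

injective⇒∣∣≤ : ∀ {m n} (S : Subset n) (g : ∀ v → v ∈ S → Fin m) →
  (∀ {u v} (u∈S : u ∈ S) (v∈S : v ∈ S) → g u u∈S ≡ g v v∈S → u ≡ v) → ∣ S ∣ ≤ m
injective⇒∣∣≤ S g inj = Fin.injective⇒≤ {f = λ i → g (enum S i) (enum-∈ S i)} λ {i} {j} eq →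
  enum-injective S (inj (enum-∈ S i) (enum-∈ S j) eq)

-- Pigeonhole: were `p` missed, punching it out would inject `S` into a set with one element fewer
-- than the codomain.
injective⇒onto : ∀ {m n} (S : Subset n) (g : Fin n → Fin m) →
  (∀ {u v} → u ∈ S → v ∈ S → g u ≡ g v → u ≡ v) → m ≤ ∣ S ∣ → ∀ p → ∃[ u ] u ∈ S × g u ≡ p
injective⇒onto {suc m} S g inj m≤∣S∣ p
  with Fin.any? (λ u → u Subset.∈? S ×-dec g u Fin.≟ p)
... | yes found = found
... | no ¬found = contradiction (≤-trans m≤∣S∣
  (injective⇒∣∣≤ S (λ v v∈S → punchOut (missed v∈S))
                   (λ u∈S v∈S eq → inj u∈S v∈S (Fin.punchOut-injective (missed u∈S) (missed v∈S) eq)))) 1+n≰n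
  where
  missed : ∀ {v} → v ∈ S → p ≢ g v
  missed v∈S p≡gv = ¬found (_ , v∈S , sym p≡gv)

module _ {n} {P : Fin n → Set} (P? : ∀ v → Dec (P v)) where

  ⟪_⟫ : Subset n
  ⟪_⟫ = Vec.tabulate (does ∘ P?)

  ∈⟪⟫⁺ : ∀ {v} → P v → v ∈ ⟪_⟫
  ∈⟪⟫⁺ {v} Pv = Vec.lookup⇒[]= v _ (trans (Vec.lookup∘tabulate _ v) (lemma (P? v)))
    where lemma : (d : Dec (P v)) → does d ≡ true
          lemma (yes _) = refl
          lemma (no ¬p) = contradiction Pv ¬p

  ∈⟪⟫⁻ : ∀ {v} → v ∈ ⟪_⟫ → P v
  ∈⟪⟫⁻ {v} v∈ with P? v | trans (sym (Vec.lookup∘tabulate (does ∘ P?) v)) (Vec.[]=⇒lookup v∈)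
  ... | yes Pv | _ = Pv

-- The i-th smallest element of S ∪ {n, n + 1, …}.
nth : ∀ {n} → Subset n → ℕ → ℕ
nth []          i       = i
nth (true  ∷ S) zero    = 0
nth (true  ∷ S) (suc i) = suc (nth S i)
nth (false ∷ S) i       = suc (nth S i)

nth-< : ∀ {n} (S : Subset n) i → nth S i < nth S (suc i)
nth-< []          i       = ≤-refl
nth-< (true  ∷ S) zero    = s≤s z≤n
nth-< (true  ∷ S) (suc i) = s≤s (nth-< S i)
nth-< (false ∷ S) i       = s≤s (nth-< S i)

nth-mono : ∀ {n} (S : Subset n) {i j} → i ≤ j → nth S i ≤ nth S j
nth-mono []          h       = h
nth-mono (true  ∷ S) z≤n     = z≤n
nth-mono (true  ∷ S) (s≤s h) = s≤s (nth-mono S h)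
nth-mono (false ∷ S) h       = s≤s (nth-mono S h)

nth-∣∣ : ∀ {n} (S : Subset n) → nth S ∣ S ∣ ≡ n
nth-∣∣ []          = refl
nth-∣∣ (true  ∷ S) = cong suc (nth-∣∣ S)
nth-∣∣ (false ∷ S) = cong suc (nth-∣∣ S)

nth-suc-∣∣ : ∀ {n} (S : Subset n) → nth S (suc ∣ S ∣) ≡ suc n
nth-suc-∣∣ []          = refl
nth-suc-∣∣ (true  ∷ S) = cong suc (nth-suc-∣∣ S)
nth-suc-∣∣ (false ∷ S) = cong suc (nth-suc-∣∣ S)

nth-∈ : ∀ {n} (S : Subset n) i {v} → nth S i ≡ toℕ v → v ∈ S
nth-∈ (true  ∷ S) zero    {zero}  eq = Vec.here
nth-∈ (true  ∷ S) (suc i) {suc v} eq = Vec.there (nth-∈ S i (suc-injective eq))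
nth-∈ (false ∷ S) i       {suc v} eq = Vec.there (nth-∈ S i (suc-injective eq))

nth-first : ∀ {n} (S : Subset n) {v} → v ∈ S → nth S 0 ≤ toℕ v
nth-first (true  ∷ S) v∈S             = z≤n
nth-first (false ∷ S) (Vec.there v∈S) = s≤s (nth-first S v∈S)

nth-gap : ∀ {n} (S : Subset n) i {v} → nth S i < toℕ v → toℕ v < nth S (suc i) → v ∉ S
nth-gap (true  ∷ S) zero    _         (s≤s v<) (Vec.there v∈S) = <⇒≱ v< (nth-first S v∈S)
nth-gap (true  ∷ S) (suc i) (s≤s <v) (s≤s v<) (Vec.there v∈S) = nth-gap S i <v v< v∈S
nth-gap (false ∷ S) i       (s≤s <v) (s≤s v<) (Vec.there v∈S) = nth-gap S i <v v< v∈S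

-- Boolean tests and the relations they decide.

¬T-∨ : ∀ {p q} → ¬ T p → ¬ T q → ¬ T (p ∨ q)
¬T-∨ ¬p ¬q = [ ¬p , ¬q ]′ ∘ to Bool.T-∨

T-not⇒¬T : ∀ {p} → T (not p) → ¬ T p
T-not⇒¬T {false} _ ()

¬T⇒T-not : ∀ {p} → ¬ T p → T (not p)
¬T⇒T-not {false} _  = _
¬T⇒T-not {true}  ¬p = contradiction _ ¬p

¬T-not⇒T : ∀ {p} → ¬ T (not p) → T p
¬T-not⇒T {true}  _  = _
¬T-not⇒T {false} ¬p = contradiction _ ¬p

¬T-∧-not : ∀ {p q} → (T p → T q) → ¬ T (p ∧ not q)
¬T-∧-not p⇒q p∧¬q = let (p , ¬q) = to Bool.T-∧ p∧¬q in T-not⇒¬T ¬q (p⇒q p)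

¬T-∧-not⇒ : ∀ {p q} → ¬ T (p ∧ not q) → T p → T q
¬T-∧-not⇒ h p = ¬T-not⇒T λ ¬q → h (from Bool.T-∧ (p , ¬q))

T-ext : ∀ {p q} → (T p → T q) → (T q → T p) → p ≡ q
T-ext {false} {false} _ _ = refl
T-ext {true}  {true}  _ _ = refl
T-ext {false} {true}  _ h = contradiction (h _) id
T-ext {true}  {false} h _ = contradiction (h _) id

sameTriple⇒≡ : ∀ {t u} → T (sameTriple t u) → t ≡ u
sameTriple⇒≡ h = let (p , qr) = to Bool.T-∧ h ; (q , r) = to Bool.T-∧ qr in
  cong₂ _,_ (≡ᵇ⇒≡ _ _ p) (cong₂ _,_ (≡ᵇ⇒≡ _ _ q) (≡ᵇ⇒≡ _ _ r))

sameTriple-refl : ∀ t → T (sameTriple t t)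
sameTriple-refl (i , a , b) = from Bool.T-∧ (≡⇒≡ᵇ i i refl , from Bool.T-∧ (≡⇒≡ᵇ a a refl , ≡⇒≡ᵇ b b refl))

same⇒≡ : ∀ {D} {ts us : Vec Triple D} → T (same ts us) → ts ≡ us
same⇒≡ {ts = []}     {[]}     _ = refl
same⇒≡ {ts = t ∷ ts} {u ∷ us} h = let (p , q) = to Bool.T-∧ h in cong₂ _∷_ (sameTriple⇒≡ p) (same⇒≡ q)

same-refl : ∀ {D} (ts : Vec Triple D) → T (same ts ts)
same-refl []       = _
same-refl (t ∷ ts) = from Bool.T-∧ (sameTriple-refl t , same-refl ts)

same-sym : ∀ {D} (ts us : Vec Triple D) → same ts us ≡ same us ts
same-sym ts us = T-ext (swap ts us) (swap us ts)
  where swap : ∀ ts us → T (same ts us) → T (same us ts)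
        swap ts us h = subst (λ vs → T (same vs ts)) (same⇒≡ {ts = ts} h) (same-refl ts)

slot : Triple → ℕ
slot = proj₁

-- The propositional reading of the negation of `clash`, one field per disjunct.
record Compatible (n k : ℕ) (t t′ : Triple) : Set where
  field
    increasing : proj₁ (proj₂ t) < proj₂ (proj₂ t)
    first      : slot t ≡ 0 → proj₁ (proj₂ t) ≡ 0
    last       : slot t ≡ suc k → proj₁ (proj₂ t) ≡ suc n
    agree      : slot t ≡ slot t′ → t ≡ t′
    successive : suc (slot t) ≡ slot t′ → proj₂ (proj₂ t) ≡ proj₁ (proj₂ t′)

module _ {n k : ℕ} where

  ¬clash⇒compatible : ∀ t t′ → ¬ T (clash n k t t′) → Compatible n k t t′
  ¬clash⇒compatible (i , a , b) (j , c , d) h = record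
    { increasing = <ᵇ⇒< a b (¬T-not⇒T h₁)
    ; first      = λ eq → ≡ᵇ⇒≡ a 0 (¬T-∧-not⇒ h₂ (≡⇒≡ᵇ i 0 eq))
    ; last       = λ eq → ≡ᵇ⇒≡ a (suc n) (¬T-∧-not⇒ h₃ (≡⇒≡ᵇ i (suc k) eq))
    ; agree      = λ eq → let (p , q) = to Bool.T-∧ (¬T-∧-not⇒ h₄ (≡⇒≡ᵇ i j eq)) in
                          cong₂ _,_ eq (cong₂ _,_ (≡ᵇ⇒≡ a c p) (≡ᵇ⇒≡ b d q))
    ; successive = λ eq → ≡ᵇ⇒≡ b c (¬T-∧-not⇒ h₅ (≡⇒≡ᵇ (suc i) j eq))
    }
    where
    h₁ = h ∘ from Bool.T-∨ ∘ inj₁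
    g₂ = h ∘ from (Bool.T-∨ {not (a <ᵇ b)}) ∘ inj₂
    h₂ = g₂ ∘ from Bool.T-∨ ∘ inj₁
    g₃ = g₂ ∘ from (Bool.T-∨ {(i ≡ᵇ 0) ∧ not (a ≡ᵇ 0)}) ∘ inj₂
    h₃ = g₃ ∘ from Bool.T-∨ ∘ inj₁
    g₄ = g₃ ∘ from (Bool.T-∨ {(i ≡ᵇ suc k) ∧ not (a ≡ᵇ suc n)}) ∘ inj₂
    h₄ = g₄ ∘ from Bool.T-∨ ∘ inj₁
    h₅ = g₄ ∘ from (Bool.T-∨ {(i ≡ᵇ j) ∧ not ((a ≡ᵇ c) ∧ (b ≡ᵇ d))}) ∘ inj₂

  compatible⇒¬clash : ∀ t t′ → Compatible n k t t′ → ¬ T (clash n k t t′)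
  compatible⇒¬clash (i , a , b) (j , c , d) h =
    ¬T-∨ {not (a <ᵇ b)} (λ p → T-not⇒¬T p (<⇒<ᵇ C.increasing))
    (¬T-∨ {(i ≡ᵇ 0) ∧ not (a ≡ᵇ 0)} (¬T-∧-not (≡⇒≡ᵇ a 0 ∘ C.first ∘ ≡ᵇ⇒≡ i 0))
    (¬T-∨ {(i ≡ᵇ suc k) ∧ not (a ≡ᵇ suc n)} (¬T-∧-not (≡⇒≡ᵇ a (suc n) ∘ C.last ∘ ≡ᵇ⇒≡ i (suc k)))
    (¬T-∨ {(i ≡ᵇ j) ∧ not ((a ≡ᵇ c) ∧ (b ≡ᵇ d))}
          (¬T-∧-not λ p → from Bool.T-∧
             (≡⇒≡ᵇ a c (cong (proj₁ ∘ proj₂) (C.agree (≡ᵇ⇒≡ i j p))) ,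
              ≡⇒≡ᵇ b d (cong (proj₂ ∘ proj₂) (C.agree (≡ᵇ⇒≡ i j p)))))
          (¬T-∧-not (≡⇒≡ᵇ b c ∘ C.successive ∘ ≡ᵇ⇒≡ (suc i) j)))))
    where module C = Compatible h

module _ {n k : ℕ} (φ : List (List (Bool × ℕ))) {w : List Triple} where

  ¬bad⇒compatible : ¬ T (bad ((n , φ) , k) w) → ∀ {t t′} → t Mem.∈ w → t′ Mem.∈ w → Compatible n k t t′
  ¬bad⇒compatible h t∈w t′∈w = ¬clash⇒compatible _ _ λ c →
    h (from Bool.T-∨ (inj₁ (Any.any⁺ _ (Mem.lose t∈w (Any.any⁺ _ (Mem.lose t′∈w c))))))

  ¬bad⇒unfalsified : ¬ T (bad ((n , φ) , k) w) → ∀ {C} → C Mem.∈ φ →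
    ¬ All (λ l → ∃[ t ] t Mem.∈ w × T (falsifies l t)) C
  ¬bad⇒unfalsified h C∈φ falsified = h (from (Bool.T-∨ {any (λ t → any (clash n k t) w) w}) (inj₂
    (Any.any⁺ _ (Mem.lose C∈φ (All.all⁻ _ (All.map (λ (t , t∈w , p) → Any.any⁺ _ (Mem.lose t∈w p)) falsified))))))

  ¬bad⁺ : (∀ {t t′} → t Mem.∈ w → t′ Mem.∈ w → Compatible n k t t′) →
    (∀ {C} → C Mem.∈ φ → ¬ All (λ l → ∃[ t ] t Mem.∈ w × T (falsifies l t)) C) →
    ¬ T (bad ((n , φ) , k) w)
  ¬bad⁺ compatible unfalsified = ¬T-∨
    (λ p → let (t , t∈w , q) = Mem.find (Any.any⁻ _ w p) ; (t′ , t′∈w , c) = Mem.find (Any.any⁻ _ w q) in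
           compatible⇒¬clash t t′ (compatible t∈w t′∈w) c)
    (λ p → let (C , C∈φ , q) = Mem.find (Any.any⁻ _ φ p) in
           unfalsified C∈φ (All.map (λ r → Mem.find (Any.any⁻ _ w r)) (All.all⁺ _ C q)))

-- Base-`S` numerals.

module _ {S : ℕ} .{{_ : NonZero S}} where

  -- The remainder modulo `S` recovers the low digit; cancelling it leaves the rest.
  i+S*c-injective : ∀ {i j c c′} → i < S → j < S → i + S * c ≡ j + S * c′ → i ≡ j × c ≡ c′
  i+S*c-injective {i} {j} {c} {c′} i<S j<S eq = i≡j , *-cancelˡ-≡ c c′ S (+-cancelˡ-≡ i _ _ (trans eq (cong (_+ S * c′) (sym i≡j))))
    where
    remainder : ∀ {i} c → i < S → (i + S * c) % S ≡ i
    remainder {i} c i<S = trans (cong (λ z → (i + z) % S) (*-comm S c)) (trans ([m+kn]%n≡m%n i c S) (m<n⇒m%n≡m i<S))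
    i≡j = trans (sym (remainder c i<S)) (trans (cong (_% S) eq) (remainder c′ j<S))

  value-injective : ∀ {D} {I J : Vec ℕ D} → VAll (_< S) I → VAll (_< S) J → value S I ≡ value S J → I ≡ J
  value-injective []           []           _  = refl
  value-injective (i<S ∷ I<S) (j<S ∷ J<S) eq =
    let (i≡j , c≡c′) = i+S*c-injective i<S j<S eq in cong₂ _∷_ i≡j (value-injective I<S J<S c≡c′)

  value-< : ∀ {D} {I : Vec ℕ D} → VAll (_< S) I → value S I < S ^ D
  value-< []                   = ≤-refl
  value-< {suc D} {i ∷ I} (i<S ∷ I<S) = begin-strict
    i + S * value S I   <⟨ +-monoˡ-< _ i<S ⟩
    S + S * value S I   ≡⟨ *-suc S (value S I) ⟨
    S * suc (value S I) ≤⟨ *-monoʳ-≤ S (value-< I<S) ⟩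
    S * S ^ D           ∎
    where open ≤-Reasoning

  digits : ∀ D {p} → p < S ^ D → ∃[ I ] VAll (_< S) {n = D} I × value S I ≡ p
  digits zero    {zero} _ = [] , [] , refl
  digits zero    {suc p} (s≤s ())
  digits (suc D) {p} p<   =
    let (I , I<S , eq) = digits D {p / S} (m<n*o⇒m/o<n (<-≤-trans p< (≤-reflexive (*-comm S (S ^ D))))) in
    p % S ∷ I , m%n<n p S ∷ I<S ,
    trans (cong (λ z → p % S + S * z) eq) (trans (cong (p % S +_) (*-comm S (p / S))) (sym (m≡m%n+[m/n]*n p S)))

-- Enumeration of triples and tuples.

lookup-injective : ∀ {A : Set} {xs : List A} → Unique xs → ∀ {i j} → List.lookup xs i ≡ List.lookup xs j → i ≡ j
lookup-injective (_   ∷ _)  {zero}  {zero}  _  = refl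
lookup-injective (x∉ ∷ _)  {zero}  {suc j} eq = contradiction eq (All.lookup x∉ (List.∈-lookup j))
lookup-injective (x∉ ∷ _)  {suc i} {zero}  eq = contradiction (sym eq) (All.lookup x∉ (List.∈-lookup i))
lookup-injective (_   ∷ u) {suc i} {suc j} eq = cong suc (lookup-injective u eq)

module _ {A : Set} {xs : List A} where

  ∈-tuples⁺ : ∀ {D} {ts : Vec A D} → VAll (Mem._∈ xs) ts → ts Mem.∈ tuples D xs
  ∈-tuples⁺ []       = here refl
  ∈-tuples⁺ (p ∷ ps) = List.∈-cartesianProductWith⁺ _∷_ p (∈-tuples⁺ ps)

  ∈-tuples⁻ : ∀ D {ts : Vec A D} → ts Mem.∈ tuples D xs → VAll (Mem._∈ xs) ts
  ∈-tuples⁻ zero    (here refl) = []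
  ∈-tuples⁻ (suc D) ts∈ with List.∈-cartesianProductWith⁻ _∷_ xs (tuples D xs) ts∈
  ... | t , us , t∈ , us∈ , refl = t∈ ∷ ∈-tuples⁻ D us∈

  tuples-unique : ∀ D → Unique xs → Unique (tuples D xs)
  tuples-unique zero    _  = [] ∷ []
  tuples-unique (suc D) xs! = Unique.cartesianProductWith⁺ _∷_ Vec.∷-injective xs! (tuples-unique D xs!)

module _ {S V : ℕ} where

  ∈-triples⁺ : ∀ {i a b} → i < S → a < V → b < V → (i , a , b) Mem.∈ triples S V
  ∈-triples⁺ i<S a<V b<V = List.∈-cartesianProductWith⁺ _,_ (List.∈-downFrom⁺ i<S)
    (List.∈-cartesianProductWith⁺ _,_ (List.∈-downFrom⁺ a<V) (List.∈-downFrom⁺ b<V))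

  ∈-triples⁻ : ∀ {t} → t Mem.∈ triples S V → slot t < S
  ∈-triples⁻ t∈ with List.∈-cartesianProductWith⁻ _,_ (downFrom S) _ t∈
  ... | i , ab , i∈ , _ , refl = List.∈-downFrom⁻ i∈

  triples-unique : Unique (triples S V)
  triples-unique = pairs (Unique.downFrom⁺ S) (pairs (Unique.downFrom⁺ V) (Unique.downFrom⁺ V))
    where
    pairs : ∀ {A B : Set} {xs : List A} {ys : List B} → Unique xs → Unique ys → Unique (cartesianProductWith _,_ xs ys)
    pairs = Unique.cartesianProductWith⁺ _,_ (λ { refl → refl , refl })

-- Correctness of the construction

literal : ∀ {n} → Literal n → Bool × ℕ
literal (pos v) = true  , toℕ v
literal (neg v) = false , toℕ v

-- Used in contrapositive form: distinct tuples with the same slots read some slot in two different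
-- ways, which is a clash. Hence each part is a clique.
compatible-≡ : ∀ {D} {us vs : Vec Triple D} → Vec.map slot us ≡ Vec.map slot vs →
  (∀ {t t′} → t Mem.∈ Vec.toList us → t′ Mem.∈ Vec.toList vs → slot t ≡ slot t′ → t ≡ t′) → us ≡ vs
compatible-≡ {us = []}     {[]}     _  _     = refl
compatible-≡ {us = u ∷ us} {v ∷ vs} eq agree = let (eq₁ , eq₂) = Vec.∷-injective eq in
  cong₂ _∷_ (agree (here refl) (here refl) eq₁)
            (compatible-≡ eq₂ λ t∈ t′∈ → agree (there t∈) (there t′∈))

all-replicate : ∀ {A : Set} {P : A → Set} n {x} → P x → VAll P (Vec.replicate n x)
all-replicate zero    px = []
all-replicate (suc n) px = px ∷ all-replicate n px

-- Gathers one witnessing slot per literal into a vector of the fixed length `D`; the places left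
-- over are filled with slot 0.
cover-slots : ∀ {L : Set} (R : L → ℕ → Set) {S D} {C : List L} → 0 < S →
  All (λ l → ∃[ j ] j < S × R l j) C → length C ≤ D →
  ∃[ I ] VAll (_< S) {n = D} I × All (λ l → ∃[ j ] j Mem.∈ Vec.toList I × R l j) C
cover-slots R {D = D} 0<S []                     _        = Vec.replicate D 0 , all-replicate D 0<S , []
cover-slots R         0<S ((j , j<S , r) ∷ rest) (s≤s C≤D) =
  let (I , I<S , rs) = cover-slots R 0<S rest C≤D in
  j ∷ I , j<S ∷ I<S , (j , here refl , r) ∷ All.map (λ (j , j∈ , r) → j , there j∈ , r) rs

predecessor : ∀ {n m} → 0 < m → m < suc n → ∃[ v ] suc (toℕ {n} v) ≡ m
predecessor {m = suc m} _ (s≤s m<n) = fromℕ< m<n , cong suc (Fin.toℕ-fromℕ< m<n)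

falsifies-pos : ∀ t {v} → proj₁ (proj₂ t) < suc v → suc v < proj₂ (proj₂ t) → T (falsifies (true , v) t)
falsifies-pos (i , a , b) {v} a<v v<b = from (Bool.T-∧ {a <ᵇ suc v}) (<⇒<ᵇ a<v , <⇒<ᵇ v<b)

falsifies-neg : ∀ t {v} → proj₁ (proj₂ t) ≡ suc v → T (falsifies (false , v) t)
falsifies-neg (i , a , b) = ≡⇒≡ᵇ a _

head-∈ : ∀ {A : Set} {D} (xs : Vec A (suc D)) → Vec.head xs Mem.∈ Vec.toList xs
head-∈ (x ∷ xs) = here refl

-- The vertex list is abstract here: it enters through its freedom from repetition, its containing
-- all tuples of admissible triples, and the slot bound, never through its enumeration.
module Construction
  (d n k : ℕ) (φ : List (Clause n)) (width : All (λ C → length C ≤ d) φ)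
  (vs : List (Vec Triple (suc d))) (unique : Unique vs)
  (complete : ∀ {ts} → VAll (Mem._∈ triples (2 + k) (3 + n)) ts → ts Mem.∈ vs)
  (sound : ∀ {ts} → ts Mem.∈ vs → VAll (λ t → slot t < 2 + k) ts)
  where

  D S V K : ℕ
  D = suc d
  S = 2 + k
  V = 3 + n
  K = S ^ D

  clauses : List (List (Bool × ℕ))
  clauses = map (map literal) φ

  x : Input
  x = (n , clauses) , k

  N : ℕ
  N = length vs

  at : Fin N → Vec Triple D
  at = List.lookup vs

  list : Fin N → List Triple
  list = Vec.toList ∘ at

  at-injective : ∀ {u v} → at u ≡ at v → u ≡ v
  at-injective = lookup-injective unique

  at-surjective : ∀ {ts} → VAll (Mem._∈ triples S V) ts → ∃[ u ] at u ≡ ts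
  at-surjective ts∈ = Any.index (complete ts∈) , sym (Any.lookup-index (complete ts∈))

  slots-< : ∀ u → VAll (_< S) (Vec.map slot (at u))
  slots-< u = VecAll.map⁺ (sound (List.∈-lookup {xs = vs} u))

  G : Graph N
  G = record
    { adj    = λ u v → adjacent x (at u) (at v)
    ; sym    = λ u v → cong₂ (λ p q → not p ∧ q) (same-sym (at u) (at v)) (Bool.∨-comm (bad x (list u ++ list v)) _)
    ; irrefl = λ u → cong (λ p → not p ∧ (bad x (list u ++ list u) ∨ bad x (list u ++ list u))) (to Bool.T-≡ (same-refl (at u)))
    }

  open Graph G using (Adj)

  bad⇒adj : ∀ {u v} → u ≢ v → T (bad x (list u ++ list v)) → Adj u v
  bad⇒adj u≢v b = to Bool.T-≡ (from Bool.T-∧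
    (¬T⇒T-not (u≢v ∘ at-injective ∘ same⇒≡) , from Bool.T-∨ (inj₁ b)))

  adj⇒bad : ∀ {u v} → Adj u v → T (bad x (list u ++ list v)) ⊎ T (bad x (list v ++ list u))
  adj⇒bad {u} {v} uv = to Bool.T-∨ (proj₂ (to (Bool.T-∧ {not (same (at u) (at v))}) (from Bool.T-≡ uv)))

  part : Fin N → Fin K
  part u = fromℕ< (value-< (slots-< u))

  toℕ-part : ∀ u → toℕ (part u) ≡ class S (at u)
  toℕ-part u = Fin.toℕ-fromℕ< (value-< (slots-< u))

  part-slots : ∀ {u v} → part u ≡ part v → Vec.map slot (at u) ≡ Vec.map slot (at v)
  part-slots {u} {v} eq = value-injective (slots-< u) (slots-< v)
    (trans (sym (toℕ-part u)) (trans (cong toℕ eq) (toℕ-part v)))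

  ∈ˡ : ∀ {u v t} → t Mem.∈ list u → t Mem.∈ list u ++ list v
  ∈ˡ = List.∈-++⁺ˡ

  ∈ʳ : ∀ u {v t} → t Mem.∈ list v → t Mem.∈ list u ++ list v
  ∈ʳ u = List.∈-++⁺ʳ (list u)

  part-clique : ∀ u v → part u ≡ part v → u ≢ v → Adj u v
  part-clique u v eq u≢v = bad⇒adj u≢v (lemma (Bool.T? _))
    where
    lemma : Dec (T (bad x (list u ++ list v))) → T (bad x (list u ++ list v))
    lemma (yes b) = b
    -- Without a clash, equal slots force equal triples, hence `u` and `v` would coincide.
    lemma (no ¬b) = contradiction (at-injective (compatible-≡ (part-slots eq) λ t∈ t′∈ →
      Compatible.agree (¬bad⇒compatible clauses ¬b (∈ˡ t∈) (∈ʳ u t′∈)))) u≢v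

  -- A choice `τ` of one triple per slot yields one vertex in each part: apply `τ` to the base-`S`
  -- digits of the number of the part. This serves twice, with arbitrary triples to see that every
  -- part is nonempty and with those of a satisfying assignment.
  module Section (τ : ℕ → Triple) (slot-τ : ∀ i → slot (τ i) ≡ i)
                 (τ∈ : ∀ {i} → i < S → τ i Mem.∈ triples S V) where

    digit : Fin K → Vec ℕ D
    digit p = proj₁ (digits {S} D (Fin.toℕ<n p))

    private
      vertex : ∀ p → ∃[ u ] at u ≡ Vec.map τ (digit p)
      vertex p = at-surjective (VecAll.map⁺ (VecAll.map τ∈ (proj₁ (proj₂ (digits {S} D (Fin.toℕ<n p))))))

    section : Fin K → Fin N
    section p = proj₁ (vertex p)

    at-section : ∀ p → at (section p) ≡ Vec.map τ (digit p)
    at-section p = proj₂ (vertex p)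

    part-section : ∀ p → part (section p) ≡ p
    part-section p = Fin.toℕ-injective (begin
      toℕ (part (section p))             ≡⟨ toℕ-part (section p) ⟩
      class S (at (section p))           ≡⟨ cong (class S) (at-section p) ⟩
      class S (Vec.map τ (digit p))      ≡⟨ cong (value S) (Vec.map-∘ slot τ (digit p)) ⟨
      value S (Vec.map (slot ∘ τ) (digit p)) ≡⟨ cong (value S) (trans (Vec.map-cong slot-τ (digit p)) (Vec.map-id (digit p))) ⟩
      value S (digit p)                  ≡⟨ proj₂ (proj₂ (digits {S} D (Fin.toℕ<n p))) ⟩
      toℕ p                              ∎)
      where open ≡-Reasoning

    -- The section hits `K` different vertices, since they lie in different parts, and all of them
    -- are outside `X`.
    avoids⇒∣∣≤ : (X : Subset N) → (∀ p → section p ∉ X) → ∣ X ∣ ≤ N ∸ K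
    avoids⇒∣∣≤ X avoids = begin
      ∣ X ∣            ≡⟨ m∸[m∸n]≡n (Subset.∣p∣≤n X) ⟨
      N ∸ (N ∸ ∣ X ∣)  ≤⟨ ∸-monoʳ-≤ N K≤ ⟩
      N ∸ K            ∎
      where
      open ≤-Reasoning
      K≤ : K ≤ N ∸ ∣ X ∣
      K≤ = ≤-trans
        (injective⇒≤∣∣ (∁ X) section (Subset.x∉p⇒x∈∁p ∘ avoids)
          λ {p} {q} eq → trans (sym (part-section p)) (trans (cong part eq) (part-section q)))
        (≤-reflexive (Subset.∣∁p∣≡n∸∣p∣ X))

  -- Its triples violate a < b, so this vertex is adjacent to all others.
  hub : Fin N
  hub = proj₁ (at-surjective {Vec.replicate D (0 , 0 , 0)} (all-replicate D (∈-triples⁺ (s≤s z≤n) (s≤s z≤n) (s≤s z≤n))))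

  at-hub : at hub ≡ Vec.replicate D (0 , 0 , 0)
  at-hub = proj₂ (at-surjective {Vec.replicate D (0 , 0 , 0)} (all-replicate D (∈-triples⁺ (s≤s z≤n) (s≤s z≤n) (s≤s z≤n))))

  hub-∈ : (0 , 0 , 0) Mem.∈ list hub
  hub-∈ rewrite at-hub = here refl

  hub-bad : ∀ {w} → (0 , 0 , 0) Mem.∈ w → T (bad x w)
  hub-bad {w} z∈w with Bool.T? (bad x w)
  ... | yes b = b
  ... | no ¬b = contradiction (Compatible.increasing (¬bad⇒compatible clauses ¬b z∈w z∈w)) λ ()

  adj-hubˡ : ∀ {v} → hub ≢ v → Adj hub v
  adj-hubˡ h≢v = bad⇒adj h≢v (hub-bad (∈ˡ hub-∈))

  adj-hubʳ : ∀ {v} → v ≢ hub → Adj v hub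
  adj-hubʳ {v} v≢h = bad⇒adj v≢h (hub-bad (∈ʳ v hub-∈))

  -- Any two vertices are joined by a walk through `hub`; the cases only treat `hub` being an
  -- endpoint.
  hub-∈⇒connected : ∀ {X} → hub ∈ X → InducesConnected G X
  hub-∈⇒connected {X} hub∈X u v u∈X v∈X = toHub (u Fin.≟ hub)
    where
    fromHub : Dec (hub ≡ v) → Star (InducedAdj G X) hub v
    fromHub (yes refl) = ε
    fromHub (no h≢v)   = (hub∈X , v∈X , adj-hubˡ h≢v) ◅ ε
    toHub : Dec (u ≡ hub) → Star (InducedAdj G X) u v
    toHub (yes refl) = fromHub (hub Fin.≟ v)
    toHub (no u≢h)   = (u∈X , hub∈X , adj-hubʳ u≢h) ◅ fromHub (hub Fin.≟ v)

  -- The end 1 differs from the end 0 in the triples of `hub`, so this section avoids `hub`.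
  module Base = Section (λ i → i , 0 , 1) (λ _ → refl) (λ i<S → ∈-triples⁺ i<S (s≤s z≤n) (s≤s (s≤s z≤n)))

  cover : CliqueCover G K
  cover = record
    { part       = part
    ; surjective = λ p → Base.section p , λ { refl → Base.part-section p }
    ; clique     = part-clique
    }

  -- The singleton of `hub` is avoided by the section of `Base`, so at least one vertex exists
  -- beyond one per part.
  0<N∸K : N ∸ K > 0
  0<N∸K = subst (_≤ N ∸ K) (Subset.∣⁅x⁆∣≡1 hub) (Base.avoids⇒∣∣≤ ⁅ hub ⁆ λ p p∈ → case-hub p (Subset.x∈⁅y⁆⇒x≡y hub p∈))
    where
    case-hub : ∀ p → ¬ Base.section p ≡ hub
    case-hub p eq with Base.digit p | trans (sym (Base.at-section p)) (trans (cong at eq) at-hub)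
    ... | i ∷ I | ()

  cvc : CVCInstance
  cvc = record { order = N ; graph = G ; k = K ; cover = cover ; ℓ = N ∸ K ; ℓ>0 = 0<N∸K }

  -- From a satisfying assignment to a connected vertex cover.

  module _ (A : Subset n) (∣A∣≡k : ∣ A ∣ ≡ k) (sat : Satisfies A φ) where

    private
      -- Prepending `true` makes the sentinel 0 the first position and moves variable v to position
      -- v + 1. Past the true variables `nth` goes on with the sentinels n + 1 and n + 2.
      position : ℕ → ℕ
      position = nth (true ∷ A)

      τ : ℕ → Triple
      τ i = i , position i , position (suc i)

      position-< : ∀ {i} → i ≤ 2 + k → position i < V
      position-< i≤ = s≤s (≤-trans (nth-mono (true ∷ A) i≤)
        (≤-reflexive (trans (cong (suc ∘ nth A ∘ suc) (sym ∣A∣≡k)) (cong suc (nth-suc-∣∣ A)))))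

      open Section τ (λ _ → refl) (λ i<S → ∈-triples⁺ i<S (position-< (<⇒≤ i<S)) (position-< i<S))

      Chosen : Triple → Set
      Chosen t = t ≡ τ (slot t)

      compatible : ∀ {t t′} → Chosen t → Chosen t′ → Compatible n k t t′
      compatible {i , _} {j , _} refl refl = record
        { increasing = nth-< (true ∷ A) i
        ; first      = λ { refl → refl }
        ; last       = λ { refl → cong suc (trans (cong (nth A) (sym ∣A∣≡k)) (nth-∣∣ A)) }
        ; agree      = λ { refl → refl }
        ; successive = λ { refl → refl }
        }

      -- A falsified positive literal would have its variable strictly between consecutive true
      -- positions, a falsified negative one at a true position.
      unfalsified : ∀ l → ⟦ l ⟧ A → ∀ {t} → Chosen t → ¬ T (falsifies (literal l) t)
      unfalsified (pos v) v∈A {i , _} refl f = let (p , q) = to Bool.T-∧ f in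
        nth-gap (true ∷ A) i {suc v} (<ᵇ⇒< _ _ p) (<ᵇ⇒< _ _ q) (Vec.there v∈A)
      unfalsified (neg v) v∉A {i , _} refl f = v∉A (Subset.drop-there (nth-∈ (true ∷ A) i {suc v} (≡ᵇ⇒≡ _ _ f)))

      chosen⇒¬bad : ∀ {w} → All Chosen w → ¬ T (bad x w)
      chosen⇒¬bad {w} chosen = ¬bad⁺ clauses (λ t∈ t′∈ → compatible (All.lookup chosen t∈) (All.lookup chosen t′∈)) clause
        where
        clause : ∀ {C} → C Mem.∈ clauses → ¬ All (λ l → ∃[ t ] t Mem.∈ w × T (falsifies l t)) C
        clause C∈ falsified with List.∈-map⁻ (map literal) C∈
        ... | C , C∈φ , refl =
          let (l , l∈C , true-l) = Mem.find (All.lookup sat C∈φ)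
              (t , t∈w , f) = All.lookup (All.map⁻ falsified) l∈C
          in unfalsified l true-l (All.lookup chosen t∈w) f

      -- The independent set: tuples whose triples are all read off the assignment. Its complement
      -- is the cover.
      Selected : Fin N → Set
      Selected u = All Chosen (list u)

      selected? : ∀ u → Dec (Selected u)
      selected? u = All.all? (λ t → ≡-dec _≟_ (≡-dec _≟_ _≟_) t (τ (slot t))) (list u)

      Rest : Subset N
      Rest = ⟪ ¬? ∘ selected? ⟫

      covers : IsVertexCover G Rest
      covers u v uv with selected? u | selected? v
      ... | no ¬p | _     = inj₁ (∈⟪⟫⁺ (¬? ∘ selected?) ¬p)
      ... | yes _ | no ¬q = inj₂ (∈⟪⟫⁺ (¬? ∘ selected?) ¬q)
      ... | yes p | yes q = contradiction (adj⇒bad uv)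
        [ chosen⇒¬bad (All.++⁺ p q) , chosen⇒¬bad (All.++⁺ q p) ]′

      hub∈ : hub ∈ Rest
      -- `τ 0` ends at a successor, whereas the triple of `hub` ends at 0.
      hub∈ = ∈⟪⟫⁺ (¬? ∘ selected?) λ p → contradiction (All.lookup p hub-∈) λ ()

      section-selected : ∀ p → Selected (section p)
      section-selected p = subst (All Chosen ∘ Vec.toList) (sym (at-section p)) (chosen (digit p))
        where
        chosen : ∀ {D} (I : Vec ℕ D) → All Chosen (Vec.toList (Vec.map τ I))
        chosen []      = []
        chosen (i ∷ I) = refl ∷ chosen I

    satisfiable⇒cover : ∃[ X ] IsConnectedVertexCover G X × ∣ X ∣ ≤ N ∸ K
    satisfiable⇒cover = Rest , (covers , hub-∈⇒connected hub∈) ,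
      avoids⇒∣∣≤ Rest λ p p∈ → ∈⟪⟫⁻ (¬? ∘ selected?) p∈ (section-selected p)

  -- From a vertex cover to a satisfying assignment.

  module _ (X : Subset N) (covers : IsVertexCover G X) (∣X∣≤ : ∣ X ∣ ≤ N ∸ K) where

    private
      abstract
        -- The complement of a cover is independent and the parts are cliques, so `part` is
        -- injective on it. Having at least `K` elements, it meets every part.
        choose : ∀ p → ∃[ u ] u ∈ ∁ X × part u ≡ p
        choose = injective⇒onto (∁ X) part independent K≤∣∁X∣
          where
          independent : ∀ {u v} → u ∈ ∁ X → v ∈ ∁ X → part u ≡ part v → u ≡ v
          independent {u} {v} u∈ v∈ eq with u Fin.≟ v
          ... | yes u≡v = u≡v
          ... | no u≢v  = contradiction (covers u v (part-clique u v eq u≢v))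
                            [ Subset.x∈∁p⇒x∉p u∈ , Subset.x∈∁p⇒x∉p v∈ ]′
          -- Subtraction is truncated, so `N ∸ (N ∸ K)` equals `K` only once `K ≤ N` is known;
          -- positivity of `N ∸ K` gives it.
          K≤N : K ≤ N
          K≤N = <⇒≤ (m∸n≢0⇒n<m (>⇒≢ 0<N∸K))
          K≤∣∁X∣ : K ≤ ∣ ∁ X ∣
          K≤∣∁X∣ = begin
            K             ≡⟨ m∸[m∸n]≡n K≤N ⟨
            N ∸ (N ∸ K)   ≤⟨ ∸-monoʳ-≤ N ∣X∣≤ ⟩
            N ∸ ∣ X ∣     ≡⟨ Subset.∣∁p∣≡n∸∣p∣ X ⟨
            ∣ ∁ X ∣       ∎
            where open ≤-Reasoning

      pick : Fin K → Fin N
      pick p = proj₁ (choose p)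

      part-pick : ∀ p → part (pick p) ≡ p
      part-pick p = proj₂ (proj₂ (choose p))

      pick-¬bad : ∀ {p q} → p ≢ q → ¬ T (bad x (list (pick p) ++ list (pick q)))
      pick-¬bad {p} {q} p≢q b =
        [ Subset.x∈∁p⇒x∉p (proj₁ (proj₂ (choose p))) , Subset.x∈∁p⇒x∉p (proj₁ (proj₂ (choose q))) ]′
          (covers (pick p) (pick q) (bad⇒adj (λ eq → p≢q (trans (sym (part-pick p)) (trans (cong part eq) (part-pick q)))) b))

      -- Adjacency speaks of two distinct vertices only, so the triples within one picked vertex are
      -- checked by pairing it with some other pick. There is one because `S ≥ 2` and `D ≥ 1` give
      -- `K ≥ 2`.
      another : ∀ p → ∃[ q ] p ≢ q
      another p with p Fin.≟ fromℕ< 0<K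
        where 0<K : 0 < K
              0<K = m^n>0 S D
      ... | no p≢0   = _ , p≢0
      ... | yes refl = fromℕ< 1<K , λ eq → contradiction (Fin.fromℕ<-injective 0 1 _ 1<K eq) λ ()
        where
        1<K : 1 < K
        1<K = *-mono-≤ {2} {S} {1} {S ^ d} (s≤s (s≤s z≤n)) (m^n>0 S d)

      compatible : ∀ p q {t t′} → t Mem.∈ list (pick p) → t′ Mem.∈ list (pick q) → Compatible n k t t′
      compatible p q t∈ t′∈ with p Fin.≟ q
      ... | no p≢q   = ¬bad⇒compatible clauses (pick-¬bad p≢q) (∈ˡ {pick p} {pick q} t∈) (∈ʳ (pick p) {pick q} t′∈)
      ... | yes refl = ¬bad⇒compatible clauses (pick-¬bad (proj₂ (another p))) (∈ˡ {pick p} {pick (proj₁ (another p))} t∈) (∈ˡ {pick p} {pick (proj₁ (another p))} t′∈)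

      unfalsified : ∀ p {C} → C Mem.∈ φ →
        ¬ All (λ l → ∃[ t ] t Mem.∈ list (pick p) × T (falsifies (literal l) t)) C
      unfalsified p C∈φ falsified = ¬bad⇒unfalsified clauses (pick-¬bad (proj₂ (another p)))
        (List.∈-map⁺ (map literal) C∈φ)
        (All.map⁺ (All.map (λ (t , t∈ , f) → t , ∈ˡ {pick p} {pick (proj₁ (another p))} t∈ , f) falsified))

      classOf : {I : Vec ℕ D} → VAll (_< S) I → Fin K
      classOf I<S = fromℕ< (value-< I<S)

      slots-pick : ∀ {I} (I<S : VAll (_< S) I) → Vec.map slot (at (pick (classOf I<S))) ≡ I
      slots-pick {I} I<S = value-injective (slots-< _) I<S
        (trans (sym (toℕ-part _)) (trans (cong toℕ (part-pick _)) (Fin.toℕ-fromℕ< (value-< I<S))))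

      -- The part all of whose slots are `i`. The minimum with `suc k` makes this total on the
      -- naturals and changes nothing for genuine slots.
      constant : ∀ i → Fin K
      constant i = classOf (all-replicate D {i ⊓ suc k} (s≤s (m⊓n≤n i (suc k))))

      abstract
        -- The reading of slot `i` on which the picked vertices agree. It is taken from the pick in
        -- the constant part; compatibility makes every other pick containing slot `i` use the same
        -- triple.
        σ : ℕ → Triple
        σ i = Vec.head (at (pick (constant i)))

        σ-∈ : ∀ i → σ i Mem.∈ list (pick (constant i))
        σ-∈ i = head-∈ (at (pick (constant i)))

        slot-σ : ∀ {i} → i ≤ suc k → slot (σ i) ≡ i
        slot-σ {i} i≤ = trans (sym (head-map (at (pick (constant i)))))
          (trans (cong Vec.head (slots-pick (all-replicate D {i ⊓ suc k} (s≤s (m⊓n≤n i (suc k)))))) (m≤n⇒m⊓n≡m i≤))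
          where
          head-map : ∀ {D} (ts : Vec Triple (suc D)) → Vec.head (Vec.map slot ts) ≡ slot (Vec.head ts)
          head-map (t ∷ ts) = refl

      start : ℕ → ℕ
      start i = proj₁ (proj₂ (σ i))

      σσ : ∀ i j → Compatible n k (σ i) (σ j)
      σσ i j = compatible (constant i) (constant j) (σ-∈ i) (σ-∈ j)

      end≡start : ∀ {i} → i ≤ k → proj₂ (proj₂ (σ i)) ≡ start (suc i)
      end≡start {i} i≤k = Compatible.successive (σσ i (suc i))
        (trans (cong suc (slot-σ (m≤n⇒m≤1+n i≤k))) (sym (slot-σ (s≤s i≤k))))

      start-0 : start 0 ≡ 0
      start-0 = Compatible.first (σσ 0 0) (slot-σ z≤n)

      start-last : start (suc k) ≡ suc n
      start-last = Compatible.last (σσ (suc k) 0) (slot-σ ≤-refl)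

      start-step : ∀ {i} → i ≤ k → start i < start (suc i)
      start-step {i} i≤k = subst (start i <_) (end≡start i≤k) (Compatible.increasing (σσ i i))

      start-< : ∀ {i j} → i < j → j ≤ suc k → start i < start j
      start-< {i} {suc j} (s≤s i≤j) (s≤s j≤k) with m≤n⇒m<n∨m≡n i≤j
      ... | inj₁ i<j  = <-trans (start-< i<j (m≤n⇒m≤1+n j≤k)) (start-step j≤k)
      ... | inj₂ refl = start-step j≤k

      start-injective : ∀ {i j} → i ≤ suc k → j ≤ suc k → start i ≡ start j → i ≡ j
      start-injective {i} {j} i≤ j≤ eq with <-cmp i j
      ... | tri< i<j _ _ = contradiction eq (<⇒≢ (start-< i<j j≤))
      ... | tri≈ _ i≡j _ = i≡j
      ... | tri> _ _ j<i = contradiction (sym eq) (<⇒≢ (start-< j<i i≤))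

      -- The starts increase strictly from 0 at slot 0 to n + 1 at slot k + 1, so those in between
      -- are positions of variables.
      variable-at : ∀ i → i < k → ∃[ v ] suc (toℕ {n} v) ≡ start (suc i)
      variable-at i i<k = predecessor
        (subst (_< start (suc i)) start-0 (start-< {0} (s≤s z≤n) (m≤n⇒m≤1+n i<k)))
        (subst (start (suc i) <_) start-last (start-< {suc i} (s≤s i<k) ≤-refl))

      true-at : Fin k → Fin n
      true-at i = proj₁ (variable-at (toℕ i) (Fin.toℕ<n i))

      suc-true-at : ∀ i → suc (toℕ (true-at i)) ≡ start (suc (toℕ i))
      suc-true-at i = proj₂ (variable-at (toℕ i) (Fin.toℕ<n i))

      true-at-injective : ∀ {i j} → true-at i ≡ true-at j → i ≡ j
      true-at-injective {i} {j} eq = Fin.toℕ-injective (suc-injective (start-injective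
        (m≤n⇒m≤1+n (Fin.toℕ<n i)) (m≤n⇒m≤1+n (Fin.toℕ<n j))
        (trans (sym (suc-true-at i)) (trans (cong (suc ∘ toℕ) eq) (suc-true-at j)))))

      IsTrue : Fin n → Set
      IsTrue v = ∃[ i ] true-at i ≡ v

      isTrue? : ∀ v → Dec (IsTrue v)
      isTrue? v = Fin.any? (λ i → true-at i Fin.≟ v)

      truths : Subset n
      truths = ⟪ isTrue? ⟫

      ∣truths∣≡k : ∣ truths ∣ ≡ k
      ∣truths∣≡k = ≤-antisym
        (injective⇒∣∣≤ truths (λ v v∈truths → proj₁ (∈⟪⟫⁻ isTrue? v∈truths))
          λ u∈truths v∈truths eq → trans (sym (proj₂ (∈⟪⟫⁻ isTrue? u∈truths))) (trans (cong true-at eq) (proj₂ (∈⟪⟫⁻ isTrue? v∈truths))))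
        (injective⇒≤∣∣ truths true-at (λ i → ∈⟪⟫⁺ isTrue? (i , refl)) true-at-injective)

      -- Descends from `j` to the last start that does not exceed `m`; it exists because slot 0
      -- starts at 0.
      gap : ∀ j {m} → m < start j → ∃[ i ] i < j × start i ≤ m × m < start (suc i)
      gap zero    {m} m<  = contradiction (subst (m <_) start-0 m<) λ ()
      gap (suc j) {m} m<  with m <? start j
      ... | no m≮  = j , ≤-refl , ≮⇒≥ m≮ , m<
      ... | yes m<′ = let (i , i<j , p , q) = gap j m<′ in i , m≤n⇒m≤1+n i<j , p , q

      start≢ : ∀ {v} → v ∉ truths → ∀ j → j < suc k → start j ≢ suc (toℕ v)
      start≢ v∉truths zero    _         eq = contradiction (trans (sym start-0) eq) λ ()
      start≢ v∉truths (suc i) (s≤s i<k) eq = v∉truths (∈⟪⟫⁺ isTrue? (fromℕ< i<k , Fin.toℕ-injective (suc-injective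
        (trans (suc-true-at (fromℕ< i<k)) (trans (cong (start ∘ suc) (Fin.toℕ-fromℕ< i<k)) eq)))))

      -- A false variable is the start of no slot up to k, so its position lies strictly inside the
      -- gap found by `gap`. A true variable is itself the start of a slot.
      falsifier : ∀ l → ¬ ⟦ l ⟧ truths → ∃[ j ] j < S × T (falsifies (literal l) (σ j))
      falsifier (pos v) v∉truths =
        let (j , j<1+k , start≤ , <start) = gap (suc k) (subst (suc (toℕ v) <_) (sym start-last) (s≤s (Fin.toℕ<n v))) in
        j , m≤n⇒m≤1+n j<1+k ,
        falsifies-pos (σ j) (≤∧≢⇒< start≤ (start≢ v∉truths j j<1+k))
                            (subst (suc (toℕ v) <_) (sym (end≡start (≤-pred j<1+k))) <start)
      falsifier (neg v) ¬v∉truths =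
        let (i , eq) = ∈⟪⟫⁻ isTrue? (decidable-stable (v Subset.∈? truths) ¬v∉truths) in
        -- Slot 0 belongs to the sentinel, so the true variable with index `i`, counted from 0,
        -- starts slot i + 1.
        suc (toℕ i) , s≤s (m≤n⇒m≤1+n (Fin.toℕ<n i)) ,
        falsifies-neg (σ (suc (toℕ i))) (trans (sym (suc-true-at i)) (cong (suc ∘ toℕ) eq))

      literal? : ∀ l → Dec (⟦ l ⟧ truths)
      literal? (pos v) = v Subset.∈? truths
      literal? (neg v) = ¬? (v Subset.∈? truths)

      -- The pick contains some triple of slot `j`, and its compatibility with the pick of the
      -- constant part forces that triple to be `σ j`.
      σ-∈-pick : ∀ {I} (I<S : VAll (_< S) I) {j} → j Mem.∈ Vec.toList I → σ j Mem.∈ list (pick (classOf I<S))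
      σ-∈-pick I<S {j} j∈I with slot-∈ (at (pick (classOf I<S))) (subst (λ I → j Mem.∈ Vec.toList I) (sym (slots-pick I<S)) j∈I)
        where
        slot-∈ : ∀ {D} (ts : Vec Triple D) → j Mem.∈ Vec.toList (Vec.map slot ts) → ∃[ t ] t Mem.∈ Vec.toList ts × slot t ≡ j
        slot-∈ (t ∷ ts) (here eq)  = t , here refl , sym eq
        slot-∈ (t ∷ ts) (there j∈) = let (u , u∈ , eq) = slot-∈ ts j∈ in u , there u∈ , eq
      ... | t , t∈ , eq = subst (Mem._∈ list (pick (classOf I<S)))
        (Compatible.agree (compatible _ (constant j) t∈ (σ-∈ j)) (trans eq (sym (slot-σ (j≤ I<S j∈I))))) t∈
        where
        j≤ : ∀ {D} {I : Vec ℕ D} → VAll (_< S) I → j Mem.∈ Vec.toList I → j ≤ suc k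
        j≤ (p ∷ _)  (here refl) = ≤-pred p
        j≤ (_ ∷ ps) (there j∈)  = j≤ ps j∈

      -- Suppose a clause fails. The slots falsifying its at most `d` literals fit into one vector
      -- of length d + 1, and the pick of that class contains all the corresponding `σ j`. These
      -- falsify the whole clause within a single picked vertex.
      satisfies : Satisfies truths φ
      satisfies = All.tabulate clause
        where
        clause : ∀ {C} → C Mem.∈ φ → Any (λ l → ⟦ l ⟧ truths) C
        clause {C} C∈φ = decidable-stable (Any.any? literal? C) λ ¬sat →
          let (I , I<S , falsified) = cover-slots (λ l j → T (falsifies (literal l) (σ j))) {S} {D} (s≤s z≤n)
                                        (All.map (λ {l} → falsifier l) (All.¬Any⇒All¬ C ¬sat))
                                        (m≤n⇒m≤1+n (All.lookup width C∈φ))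
          in unfalsified (classOf I<S) C∈φ (All.map (λ (j , j∈I , f) → σ j , σ-∈-pick I<S j∈I , f) falsified)

    cover⇒satisfiable : ∃[ A ] ∣ A ∣ ≡ k × Satisfies A φ
    cover⇒satisfiable = truths , ∣truths∣≡k , satisfies

-- Composition of reductions

open Problem

Computable-∘ : ∀ {f} (h : ℕᶜ ⇝ ℕᶜ) → Computable f → Computable (fun h ∘ f)
Computable-∘ h (p , run) = bind p (call (term h)) , λ k →
  let (b , t₁ , e₁ , _) = run k ; (t₂ , e₂ , _) = correct h _ in
  _ , _ , bind e₁ (call-⇓ e₂) , ≤-refl

1≤size : ∀ u → 1 ≤ size u
1≤size leaf    = ≤-refl
1≤size (u ∙ v) = s≤s z≤n

-- Follows an FPT reduction by a polynomial-time map. The first output has size at most Z = F * N ^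
-- c, so the whole costs at most a * Z ^ e = a * F ^ e * N ^ (c * e), again a function of the
-- parameter times a power of the input size. Monotonicity of `gᶜ` carries the first parameter bound
-- through.
≤ᶠᵖᵗ-extend : ∀ {A P B 𝕏 𝕐} (red : 𝕏 ⇝ 𝕐) (read : Instance P → Carrier 𝕏) (h : Instance P → Instance B) →
  (∀ y → input P y ≡ enc 𝕏 (read y)) →
  (∀ y → enc 𝕐 (fun red (read y)) ≡ input B (h y)) →
  (∀ y → Yes P y ⇔ Yes B (h y)) →
  (gᶜ : ℕᶜ ⇝ ℕᶜ) → (∀ {m n} → m ≤ n → fun gᶜ m ≤ fun gᶜ n) →
  (∀ y → param B (h y) ≤ fun gᶜ (param P y)) →
  A ≤ᶠᵖᵗ P → A ≤ᶠᵖᵗ B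
≤ᶠᵖᵗ-extend {A} {P} {B} {𝕏} {𝕐} red read h in≡ out≡ yes⇔ gᶜ g-mono param≤ r = record
  { reduce       = h ∘ R.reduce
  ; correct      = λ x → yes⇔ (R.reduce x) ⇔-∘ R.correct x
  ; g            = fun gᶜ ∘ R.g
  ; g-computable = Computable-∘ gᶜ R.g-computable
  ; param-bound  = λ x → ≤-trans (param≤ (R.reduce x)) (g-mono (R.param-bound x))
  ; f            = fun fᶜ ∘ R.f
  ; f-computable = Computable-∘ fᶜ R.f-computable
  ; c            = R.c * e
  ; program      = bind R.program (call (term red))
  ; runs         = runs
  }
  where
  module R = _≤ᶠᵖᵗ_ r

  -- In terms of Z: one step for `bind`, at most Z for the first program, then time and output size
  -- of `red`.
  total : Poly
  total = con 1 ⊕ (inp ⊕ time red ⊕ space red)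

  a e : ℕ
  a = proj₁ (⟦⟧ₚ-degree total)
  e = proj₁ (proj₂ (⟦⟧ₚ-degree total))

  fᶜ : ℕᶜ ⇝ ℕᶜ
  fᶜ = with-fun (constᶜ a *ᶜ idᶜ ^ᶜ e) (λ m → a * m ^ e)
         λ m → cong₂ _*_ (fun-constᶜ {ℕᶜ} a m) (fun-^ᶜ idᶜ e m)

  runs : ∀ x → Runs (bind R.program (call (term red))) (input A x) (input B (h (R.reduce x)))
                    (a * R.f (param A x) ^ e * size (input A x) ^ (R.c * e))
  runs x with R.runs x
  ... | t₁ , e₁ , b₁ with correct red (read (R.reduce x)) | small red (read (R.reduce x))
  ...   | t₂ , e₂ , b₂ | s≤
    rewrite sym (in≡ (R.reduce x)) | out≡ (R.reduce x)
    = suc (t₁ + t₂) , bind e₁ (call-⇓ e₂) , (begin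
      suc (t₁ + t₂ + size (input B (h (R.reduce x))))
        ≤⟨ s≤s (+-mono-≤ (+-mono-≤ (≤-trans (m≤m+n t₁ _) b₁)
                                   (≤-trans b₂ (⟦⟧ₚ-mono (time red) v≤Z)))
                         (≤-trans s≤ (⟦⟧ₚ-mono (space red) v≤Z))) ⟩
      ⟦ total ⟧ₚ Z
        ≤⟨ proj₂ (proj₂ (⟦⟧ₚ-degree total)) Z (≤-trans (1≤size (input P (R.reduce x))) v≤Z) ⟩
      a * Z ^ e
        ≡⟨ cong (a *_) ([m*n]^o≡m^o*n^o F (N ^ R.c) e) ⟩
      a * (F ^ e * (N ^ R.c) ^ e)
        ≡⟨ *-assoc a (F ^ e) ((N ^ R.c) ^ e) ⟨
      a * F ^ e * (N ^ R.c) ^ e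
        ≡⟨ cong (a * F ^ e *_) (^-*-assoc N R.c e) ⟩
      a * F ^ e * N ^ (R.c * e) ∎)
    where
    open ≤-Reasoning
    F = R.f (param A x)
    N = size (input A x)
    Z = F * N ^ R.c
    v≤Z : size (input P (R.reduce x)) ≤ Z
    v≤Z = ≤-trans (m≤n+m _ t₁) b₁

-- Encodings of instances and the final reduction.

encList-map : ∀ {A B : Set} {f : A → B} {e : B → Tree} {e′ : A → Tree} →
  (∀ a → e′ a ≡ e (f a)) → ∀ xs → encList e′ xs ≡ encList e (map f xs)
encList-map eq []       = refl
encList-map eq (x ∷ xs) = cong₂ _∙_ (eq x) (encList-map eq xs)

-- The vertices of the graph are positions in the list, while the program walks along the list
-- itself; this identifies the two encodings.
encList-allFin : ∀ {A : Set} (xs : List A) {e : A → Tree} {e′ : Fin (length xs) → Tree} →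
  (∀ u → e′ u ≡ e (List.lookup xs u)) → encList e′ (allFin (length xs)) ≡ encList e xs
encList-allFin xs {e} eq = trans (encList-map eq (allFin (length xs)))
  (cong (encList e) (trans (List.map-tabulate (λ u → u) (List.lookup xs)) (List.tabulate-lookup xs)))

module _ (d : ℕ) where

  open WSatInstance

  read : WSatInstance d → Input
  read y = (vars y , map (map literal) (clauses y)) , weight y

  input≡read : ∀ y → input (WeightedCNFSat d) y ≡ enc 𝕀 (read y)
  input≡read y = cong (λ z → (encℕ (vars y) ∙ z) ∙ encℕ (weight y)) (encList-map (encList-map literal≡) (clauses y))
    where
    literal≡ : ∀ l → encLiteral l ≡ enc (𝔹 ⊗ ℕᶜ) (literal l)
    literal≡ (pos v) = refl
    literal≡ (neg v) = refl

  module CVC (y : WSatInstance d) = Construction d (vars y) (weight y) (clauses y) (width y)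
    (vertices (suc d) (read y)) (tuples-unique (suc d) (triples-unique {slots (read y)} {values (read y)}))
    ∈-tuples⁺ (λ ts∈ → VecAll.map (∈-triples⁻ {slots (read y)} {values (read y)}) (∈-tuples⁻ (suc d) ts∈))

  reduction≡input : ∀ y → enc 𝕆 (fun (reductionᶜ (suc d)) (read y)) ≡
                          input ConnectedVertexCover/CliqueCover (CVC.cvc y)
  reduction≡input y = cong (_∙ encℕ (CVC.K y)) (cong₂ _∙_ matrix (cong (_∙ encℕ (CVC.N y ∸ CVC.K y)) parts))
    where
    vs : List (Vec Triple (suc d))
    vs = vertices (suc d) (read y)
    matrix : encList (encList encBool) (map (λ u → map (adjacent (read y) u) vs) vs) ≡ encGraph (CVC.G y)
    matrix = sym (trans
      (encList-allFin vs {e = λ u → encList encBool (map (adjacent (read y) u) vs)}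
        λ u → trans (encList-allFin vs {e = λ v → encBool (adjacent (read y) (CVC.at y u) v)} λ v → refl)
                    (encList-map {e = encBool} (λ v → refl) vs))
      (encList-map {e = encList encBool} (λ u → refl) vs))
    parts : encList encℕ (map (class (slots (read y))) vs) ≡ encList (encFin ∘ CVC.part y) (allFin (CVC.N y))
    parts = sym (trans
      (encList-allFin vs {e = encℕ ∘ class (slots (read y))} (λ u → cong encℕ (CVC.toℕ-part y u)))
      (encList-map {e = encℕ} (λ u → refl) vs))

  correctness : ∀ y → Yes (WeightedCNFSat d) y ⇔ Yes ConnectedVertexCover/CliqueCover (CVC.cvc y)
  correctness y = mk⇔
    (λ (A , ∣A∣≡k , sat) → CVC.satisfiable⇒cover y A ∣A∣≡k sat)
    (λ (X , (covers , _) , ∣X∣≤) → CVC.cover⇒satisfiable y X covers ∣X∣≤)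

  -- The new parameter as a function of k alone, a polynomial for fixed `d`.
  classesᶜ : ℕᶜ ⇝ ℕᶜ
  classesᶜ = with-fun ((sucᶜ ∘ᶜ sucᶜ) ^ᶜ suc d) (λ k → (2 + k) ^ suc d) (fun-^ᶜ (sucᶜ ∘ᶜ sucᶜ) (suc d))

  ≤ᶠᵖᵗ-CVC : ∀ {A} → A ≤ᶠᵖᵗ WeightedCNFSat d → A ≤ᶠᵖᵗ ConnectedVertexCover/CliqueCover
  ≤ᶠᵖᵗ-CVC = ≤ᶠᵖᵗ-extend (reductionᶜ (suc d)) read CVC.cvc input≡read reduction≡input correctness
    classesᶜ (λ m≤n → ^-monoˡ-≤ (suc d) (s≤s (s≤s m≤n))) (λ y → ≤-refl)

theorem16 : W[1]-Hard ConnectedVertexCover/CliqueCover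
theorem16 A (d , r) = ≤ᶠᵖᵗ-CVC d r
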